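{- Let $n, K, M$ be integers with $n=KM$, $K\ge 2$, $M \ge 1$, and consider the corrupted parallel mixnet process on $n$ cards with $M$ servers, each handling $K$ cards per round, of which $s$ servers are non-corrupted ($1\le s\le M$) and $M-s$ are corrupted, with potential $\Phi(t)=\left(\sum_{i=1}^n w_i(t)^2\right)-\frac1n$ after $t$ rounds. Let $b\ge 1$ be fixed. (i) If $s \ge \epsilon\,\frac{n-1}{K-1}$ for some $\epsilon\ge 1/2$, then after $t=\lceil b\log_2 n\rceil$ rounds, $\mathbf{E}[\Phi(t)]\le 1/n^b$. (ii) If $K\ge n^{1/c}$ for some constant $c\ge 1$ and the number $M-s$ of corrupted servers is at most $$\frac{n^{ -1/c}(n-1)}{K-1}-\frac{n-K}{K(K-1)},$$ then after $t=\lceil bc\rceil$ rounds, $\mathbf{E}[\Phi(t)]\le 1/n^b$.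
   Context: Corrupted parallel mixnet (no fake messages): there are $n$ cards (messages) and $M=n/K$ servers, of which a fixed set of $s$ servers is non-corrupted and the other $M-s$ are corrupted. In each round, (1) the cards are placed in order according to a uniformly random permutation, independent of all previous randomness, which the adversary sees; (2) under this ordering the cards are divided into $M$ consecutive groups of $K$ cards, one group per server; (3) each server permutes its $K$ cards uniformly at random; the permutation is hidden from the adversary if the server is non-corrupted and is revealed to the adversary if the server is corrupted. A corrupted server's permutation is treated as the identity, since the adversary can undo it. The adversary knows the initial ordering. $w_i(t)$ is the probability, from the point of view of the adversary, that the card in position $i$ after $t$ rounds is the card that was first at time $0$. Concretely, $w(0)=(1,0,\dots,0)$, and $w(t+1)$ is obtained from $w(t)$ by permuting the entries by a fresh uniformly random permutation of the $n$ positions, splitting the positions into $M$ consecutive blocks of size $K$ (one per server), replacing every entry in each block belonging to a non-corrupted server by the average of the $K$ entries of that block, and leaving the entries in blocks of corrupted servers unchanged. The sum-of-squares error between the card-assignment probabilities and the uniform distribution is $\Phi(t)=\sum_{i=1}^n (w_i(t)-1/n)^2 = \left(\sum_{i=1}^n w_i(t)^2\right)-1/n$. It is a random variable depending on the visible random permutations; $\mathbf{E}$ is expectation over these. -}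

module Defs where

open import Data.Bool.Base using (if_then_else_)
open import Data.Fin.Base using (Fin; zero; suc; toℕ; quotient; combine)
open import Data.Fin.Permutation using (Permutation′; id; insert; _⟨$⟩ʳ_)
open import Data.Fin.Subset using (Subset)
open import Data.Integer.Base using (ℤ; +_; -[1+_])
import Data.List.Base as List
open import Data.List.NonEmpty.Base as List⁺ using (List⁺; _∷_; [_])
open import Data.Nat.Base as ℕ using (ℕ; zero; suc; NonZero; NonTrivial)
import Data.Nat.Properties as ℕ
open import Data.Product.Base using (_×_; ∃-syntax)
open import Data.Rational.Base
  using (ℚ; 0ℚ; 1ℚ; _/_; _+_; _-_; _*_; -_; _<_; ↥_; ↧ₙ_)
open import Data.Rational.Properties using (+-*-commutativeRing)
open import Data.Sum.Base using (_⊎_)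
open import Data.Vec.Base using (Vec; []; _∷_; lookup)
open import Relation.Nullary using (¬_; does)

open import Algebra.Bundles using (CommutativeRing)
open import Algebra.Properties.Semiring.Sum
  (CommutativeRing.semiring +-*-commutativeRing) public using (sum; sum-syntax)
open import Algebra.Properties.Semiring.Exp
  (CommutativeRing.semiring +-*-commutativeRing) public using (_^_)

fromℕ : ℕ → ℚ
fromℕ k = + k / 1

record Cut : Set₁ where
  field
    lower : ℚ → Set
    upper : ℚ → Set

open Cut public

-- Real numbers are two-sided Dedekind cuts: the Cuts satisfying IsReal.  The
-- operations below act on arbitrary pairs of predicates, so they carry no
-- proofs.
record IsReal (x : Cut) : Set where
  field
    lower-inhabited : ∃[ p ] lower x p
    upper-inhabited : ∃[ q ] upper x q
    lower-rounded   : ∀ {p} → lower x p → ∃[ q ] (p < q × lower x q)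
    upper-rounded   : ∀ {q} → upper x q → ∃[ p ] (p < q × upper x p)
    lower-closed    : ∀ {p q} → p < q → lower x q → lower x p
    upper-closed    : ∀ {p q} → p < q → upper x p → upper x q
    disjoint        : ∀ {q} → ¬ (lower x q × upper x q)
    located         : ∀ {p q} → p < q → lower x p ⊎ upper x q

infix  4 _<ᴿ_ _≤ᴿ_ _≡⌈_⌉
infixl 6 _+ᴿ_ _-ᴿ_
infixl 7 _*ᴿ_
infix  8 -ᴿ_
infixr 9 _^ᴿ_

_<ᴿ_ : Cut → Cut → Set
x <ᴿ y = ∃[ q ] (upper x q × lower y q)

_≤ᴿ_ : Cut → Cut → Set
x ≤ᴿ y = ¬ (y <ᴿ x)

fromℚ : ℚ → Cut
fromℚ p = record
  { lower = λ q → q < p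
  ; upper = λ q → p < q
  }

-ᴿ_ : Cut → Cut
-ᴿ x = record
  { lower = λ q → upper x (- q)
  ; upper = λ q → lower x (- q)
  }

_+ᴿ_ : Cut → Cut → Cut
x +ᴿ y = record
  { lower = λ q → ∃[ a ] ∃[ b ] (lower x a × lower y b × q < a + b)
  ; upper = λ q → ∃[ a ] ∃[ b ] (upper x a × upper y b × a + b < q)
  }

_-ᴿ_ : Cut → Cut → Cut
x -ᴿ y = x +ᴿ (-ᴿ y)

-- Interval multiplication: if a < x < b and c < y < d then x y lies between
-- the least and the greatest of a c, a d, b c, b d.
_*ᴿ_ : Cut → Cut → Cut
x *ᴿ y = record
  { lower = λ q → ∃[ a ] ∃[ b ] ∃[ c ] ∃[ d ]
      ((lower x a × upper x b × lower y c × upper y d) ×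
       (q < a * c × q < a * d × q < b * c × q < b * d))
  ; upper = λ q → ∃[ a ] ∃[ b ] ∃[ c ] ∃[ d ]
      ((lower x a × upper x b × lower y c × upper y d) ×
       (a * c < q × a * d < q × b * c < q × b * d < q))
  }

-- 1 / x, for positive x only.
recip : Cut → Cut
recip x = record
  { lower = λ q → ∃[ r ] (upper x r × q * r < 1ℚ)
  ; upper = λ q → ∃[ r ] (lower x r × 0ℚ < r × 1ℚ < q * r)
  }

_^ℤ_ : (m : ℕ) .{{_ : NonZero m}} → ℤ → ℚ
m ^ℤ (+ k)    = fromℕ (m ℕ.^ k)
m ^ℤ -[1+ k ] = (+ 1 / (m ℕ.^ suc k)) {{ℕ.m^n≢0 m (suc k)}}

-- With r = k / d in lowest terms, q < m ^ r iff q < 0 or q ^ d < m ^ k.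
_^ℚ_ : (m : ℕ) .{{_ : NonZero m}} → ℚ → Cut
m ^ℚ r = record
  { lower = λ q → q < 0ℚ ⊎ q ^ (↧ₙ r) < m ^ℤ (↥ r)
  ; upper = λ q → 0ℚ < q × m ^ℤ (↥ r) < q ^ (↧ₙ r)
  }

-- Real exponents: the limit of the rational powers, which increase with the
-- exponent because m ≥ 1.
_^ᴿ_ : (m : ℕ) .{{_ : NonZero m}} → Cut → Cut
m ^ᴿ y = record
  { lower = λ q → ∃[ r ] (lower y r × lower (m ^ℚ r) q)
  ; upper = λ q → ∃[ r ] (upper y r × upper (m ^ℚ r) q)
  }

-- q < log₂ m iff 2 ^ q < m.
log₂ : ℕ → Cut
log₂ m = record
  { lower = λ q → upper (2 ^ℚ q) (fromℕ m)
  ; upper = λ q → lower (2 ^ℚ q) (fromℕ m)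
  }

-- A relation rather than a function, since the ceiling of a real number is not
-- computable.
_≡⌈_⌉ : ℕ → Cut → Set
t ≡⌈ x ⌉ = (fromℚ (fromℕ t - 1ℚ) <ᴿ x) × (x ≤ᴿ fromℚ (fromℕ t))

-- The expectation under the uniform distribution on a finite set, when the
-- argument lists the value at each element of the set once.
mean : List⁺ ℚ → ℚ
mean xs = List⁺.foldr₁ _+_ xs * (+ 1 / List⁺.length xs)

-- Every permutation π of Fin (suc n) agrees with insert zero j ρ for exactly
-- one j, namely the image of zero, and exactly one ρ, namely remove zero π.
permutations : ∀ n → List⁺ (Permutation′ n)
permutations zero    = [ id ]
permutations (suc n) =
  List⁺.concatMap (λ j → List⁺.map (insert zero j) (permutations n))
                  (zero ∷ List.tabulate suc)

vectors : ∀ {A : Set} → List⁺ A → ∀ t → List⁺ (Vec A t)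
vectors xs zero    = [ [] ]
vectors xs (suc t) =
  List⁺.concatMap (λ x → List⁺.map (x ∷_) (vectors xs t)) xs

-- S is the set of non-corrupted servers.
module Mixnet (K M : ℕ) .{{_ : NonTrivial K}} .{{_ : NonZero M}}
              (S : Subset M) where

  n : ℕ
  n = M ℕ.* K

  instance
    K≢0 : NonZero K
    K≢0 = ℕ.nonTrivial⇒nonZero K

    n≢0 : NonZero n
    n≢0 = ℕ.m*n≢0 M K

    K-1≢0 : NonZero (K ℕ.∸ 1)
    K-1≢0 = ℕ.>-nonZero (ℕ.m<n⇒0<n∸m (ℕ.nonTrivial⇒n>1 K))

    K[K-1]≢0 : NonZero (K ℕ.* (K ℕ.∸ 1))
    K[K-1]≢0 = ℕ.m*n≢0 K (K ℕ.∸ 1)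

  -- Server j handles the positions combine j k, that is, j K + k with k < K.
  mix : (Fin n → ℚ) → (Fin n → ℚ)
  mix v i =
    let j = quotient {M} K i in
    if lookup S j
      then (∑[ k < K ] v (combine j k)) * (+ 1 / K)
      else v i

  round : Permutation′ n → (Fin n → ℚ) → (Fin n → ℚ)
  round π v = mix (λ i → v (π ⟨$⟩ʳ i))

  -- The visible permutations are listed with the latest round first.
  w : ∀ {t} → Vec (Permutation′ n) t → Fin n → ℚ
  w []       i = if does (toℕ i ℕ.≟ 0) then 1ℚ else 0ℚ
  w (π ∷ πs)   = round π (w πs)

  Φ : ∀ {t} → Vec (Permutation′ n) t → ℚ
  Φ πs = (∑[ i < n ] (w πs i * w πs i)) - (+ 1 / n)

  𝔼Φ : ℕ → ℚ
  𝔼Φ t = mean (List⁺.map Φ (vectors (permutations n) t))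

{-# OPTIONS --safe #-}

-- Averaging over the fresh uniform permutation, every position receives a
-- uniformly random entry of w and two distinct positions receive a uniformly
-- random pair of distinct entries.  Since Σ w = 1, one round therefore
-- multiplies the expected potential by exactly ρ = 1 - s (K - 1) / (n - 1), and
-- 𝔼Φ t = ρ ^ t (1 - 1 / n).  The hypothesis of (i) says ρ ≤ 1/2 and that of (ii)
-- says ρ ≤ n ^ (- 1 / c).
--
-- For the real exponents, 𝔼Φ t > n ^ (- b) would give a rational β = k / d < b
-- with 1 < ρ ^ (t d) n ^ k.  With γ = t / β, this means log₂ n > γ in (i), and
-- ρ > n ^ (- 1 / γ) ≥ n ^ (- 1 / c) in (ii) because b c ≤ t forces c ≤ γ.
module Submission where

open import Defs
open import Algebra.Bundles using (CommutativeRing)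
open import Data.Bool.Base using (Bool; true; false; if_then_else_)
open import Data.Empty using (⊥)
open import Data.Fin.Base using (Fin; zero; suc; toℕ; punchIn; combine; _↑ˡ_; _↑ʳ_)
open import Data.Fin.Permutation using (Permutation′; insert; insert-punchIn; _⟨$⟩ʳ_)
open import Data.Fin.Properties using (punchInᵢ≢i; remQuot-combine; combine-injectiveʳ)
open import Data.Fin.Subset using (Subset; ∣_∣; inside; outside)
open import Data.Integer.Base as ℤ using (ℤ; -[1+_])
open import Data.Integer.GCD using (gcd)
import Data.Integer.Properties as ℤ
open import Data.List.Base as List using (List; []; _∷_; _++_)
import Data.List.Properties as List
open import Data.List.NonEmpty.Base as List⁺ using (List⁺; _∷_)
open import Data.Nat.Base as ℕ using (ℕ; zero; suc; NonZero; NonTrivial)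
import Data.Nat.Properties as ℕ
open import Data.Product.Base using (_,_; proj₁; proj₂; ∃-syntax; _×_)
open import Data.Rational.Base
  using ( ℚ; mkℚ; 0ℚ; 1ℚ; ½; _/_; _+_; _-_; -_; 1/_; _<_; *≤*; ↥_; ↧ₙ_; toℚᵘ
        ; positive; nonNegative )
open import Data.Rational.Properties
open import Data.Rational.Solver using (module +-*-Solver)
import Data.Rational.Unnormalised.Base as ℚᵘ
import Data.Rational.Unnormalised.Properties as ℚᵘ
open import Data.Sum.Base using (inj₁; inj₂)
open import Data.Vec.Base using (Vec; []; _∷_; lookup)
open import Function.Base using (_$_; _∘_)
open import Relation.Binary.PropositionalEquality
open import Relation.Nullary using (¬_; contradiction; does)
open import Relation.Nullary.Decidable using (from-yes)

open import Algebra.Properties.CommutativeSemiring.Exp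
  (CommutativeRing.commutativeSemiring +-*-commutativeRing)
  using (^-assocʳ; ^-distrib-*)
open import Algebra.Properties.Semiring.Sum
  (CommutativeRing.semiring +-*-commutativeRing)
  using (sum-cong-≗; sum-remove; ∑-distrib-+; sum-permute; *-distribˡ-sum; *-distribʳ-sum)
open +-*-Solver using (solve; _:=_; _:+_; _:*_; _:-_; :-_; con)

-- The embedding of ℕ in ℚ

-- With `κ` = (n - 1) / (K - 1) and `μ` = (n - K) / (K (K - 1)), the definition of `ρ` says s = (1 -
-- `ρ`) `κ`, and `κ` - `μ` = M. Hence the hypothesis of (i) reads ε ≤ 1 - `ρ`, and in (ii) the left
-- side M - s equals `ρ` `κ` - `μ`, with the same subtrahend as the right side. `x ≤ᴿ y` is the
-- negation of `y <ᴿ x`, so both bounds are proved by refutation: a supposed violation supplies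
-- rational witnesses, which are converted into a strict inequality that a hypothesis forbids.
-- Roundedness, density of the rationals and left continuity of powers provide the room that
-- strictness demands. `Large` is a violation with integral exponents only, common to (i) and (ii).
-- Averages over permutations are stated as sums multiplied out by n and n - 1, and the factorial is
-- used only through its recursion `#π-suc`.

module _ where
  open import Data.Rational.Base using (_*_; _≤_)

  -- Unnormalised rationals are not reduced, so after this transfer the equations below become
  -- identities between integers.
  toℚᵘ-/ : ∀ i d .{{_ : NonZero d}} → toℚᵘ (i / d) ℚᵘ.≃ (i ℚᵘ./ d)
  toℚᵘ-/ i (suc d) = toℚᵘ-fromℚᵘ (ℚᵘ.mkℚᵘ i d)

  fromℕ-+ : ∀ a b → fromℕ (a ℕ.+ b) ≡ fromℕ a + fromℕ b
  fromℕ-+ a b = toℚᵘ-injective $ begin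
    toℚᵘ (fromℕ (a ℕ.+ b))               ≈⟨ toℚᵘ-/ (ℤ.+ (a ℕ.+ b)) 1 ⟩
    (ℤ.+ (a ℕ.+ b)) ℚᵘ./ 1
      ≈⟨ ℚᵘ.*≡* (cong (ℤ._* ℤ.+ 1) (cong₂ ℤ._+_ (sym (ℤ.*-identityʳ (ℤ.+ a))) (sym (ℤ.*-identityʳ (ℤ.+ b))))) ⟩
    (ℤ.+ a ℚᵘ./ 1) ℚᵘ.+ (ℤ.+ b ℚᵘ./ 1)       ≈⟨ ℚᵘ.+-cong (toℚᵘ-/ (ℤ.+ a) 1) (toℚᵘ-/ (ℤ.+ b) 1) ⟨
    toℚᵘ (fromℕ a) ℚᵘ.+ toℚᵘ (fromℕ b)   ≈⟨ toℚᵘ-homo-+ (fromℕ a) (fromℕ b) ⟨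
    toℚᵘ (fromℕ a + fromℕ b)             ∎
    where open ℚᵘ.≃-Reasoning

  fromℕ-* : ∀ a b → fromℕ (a ℕ.* b) ≡ fromℕ a * fromℕ b
  fromℕ-* a b = toℚᵘ-injective $ begin
    toℚᵘ (fromℕ (a ℕ.* b))               ≈⟨ toℚᵘ-/ (ℤ.+ (a ℕ.* b)) 1 ⟩
    (ℤ.+ (a ℕ.* b)) ℚᵘ./ 1                 ≈⟨ ℚᵘ.*≡* (cong (ℤ._* ℤ.+ 1) (ℤ.pos-* a b)) ⟩
    (ℤ.+ a ℚᵘ./ 1) ℚᵘ.* (ℤ.+ b ℚᵘ./ 1)       ≈⟨ ℚᵘ.*-cong (toℚᵘ-/ (ℤ.+ a) 1) (toℚᵘ-/ (ℤ.+ b) 1) ⟨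
    toℚᵘ (fromℕ a) ℚᵘ.* toℚᵘ (fromℕ b)   ≈⟨ toℚᵘ-homo-* (fromℕ a) (fromℕ b) ⟨
    toℚᵘ (fromℕ a * fromℕ b)             ∎
    where open ℚᵘ.≃-Reasoning

  /-*-cancel : ∀ i d .{{_ : NonZero d}} → (i / d) * fromℕ d ≡ i / 1
  /-*-cancel i d@(suc _) = toℚᵘ-injective $ begin
    toℚᵘ ((i / d) * fromℕ d)             ≈⟨ toℚᵘ-homo-* (i / d) (fromℕ d) ⟩
    toℚᵘ (i / d) ℚᵘ.* toℚᵘ (fromℕ d)     ≈⟨ ℚᵘ.*-cong (toℚᵘ-/ i d) (toℚᵘ-/ (ℤ.+ d) 1) ⟩
    (i ℚᵘ./ d) ℚᵘ.* (ℤ.+ d ℚᵘ./ 1)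
      ≈⟨ ℚᵘ.*≡* (trans (ℤ.*-identityʳ _) (cong (λ e → i ℤ.* ℤ.+ e) (sym (ℕ.*-identityʳ d)))) ⟩
    i ℚᵘ./ 1                             ≈⟨ toℚᵘ-/ i 1 ⟨
    toℚᵘ (i / 1)                         ∎
    where open ℚᵘ.≃-Reasoning

  fromℕ-mono-≤ : ∀ {a b} → a ℕ.≤ b → fromℕ a ≤ fromℕ b
  fromℕ-mono-≤ {a} {b} a≤b = toℚᵘ-cancel-≤ (begin
    toℚᵘ (fromℕ a)  ≃⟨ toℚᵘ-/ (ℤ.+ a) 1 ⟩
    ℤ.+ a ℚᵘ./ 1      ≤⟨ ℚᵘ.*≤* (ℤ.*-monoʳ-≤-nonNeg (ℤ.+ 1) (ℤ.+≤+ a≤b)) ⟩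
    ℤ.+ b ℚᵘ./ 1      ≃⟨ toℚᵘ-/ (ℤ.+ b) 1 ⟨
    toℚᵘ (fromℕ b)  ∎)
    where open ℚᵘ.≤-Reasoning

  fromℕ-mono-< : ∀ {a b} → a ℕ.< b → fromℕ a < fromℕ b
  fromℕ-mono-< {a} {b} a<b = toℚᵘ-cancel-< (begin-strict
    toℚᵘ (fromℕ a)  ≃⟨ toℚᵘ-/ (ℤ.+ a) 1 ⟩
    ℤ.+ a ℚᵘ./ 1      <⟨ ℚᵘ.*<* (ℤ.*-monoʳ-<-pos (ℤ.+ 1) (ℤ.+<+ a<b)) ⟩
    ℤ.+ b ℚᵘ./ 1      ≃⟨ toℚᵘ-/ (ℤ.+ b) 1 ⟨
    toℚᵘ (fromℕ b)  ∎)
    where open ℚᵘ.≤-Reasoning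

  fromℕ-cancel-< : ∀ {a b} → fromℕ a < fromℕ b → a ℕ.< b
  fromℕ-cancel-< p = ℕ.≰⇒> λ b≤a → <-irrefl refl (<-≤-trans p (fromℕ-mono-≤ b≤a))

  fromℕ-pos : ∀ d .{{_ : NonZero d}} → 0ℚ < fromℕ d
  fromℕ-pos d = fromℕ-mono-< (ℕ.>-nonZero⁻¹ d)

-- Sums over Fin and over lists

module _ where
  open import Data.Rational.Base using (_*_; _≤_)
  open ≡-Reasoning

  fromℕ-suc : ∀ a → fromℕ (suc a) ≡ 1ℚ + fromℕ a
  fromℕ-suc = fromℕ-+ 1

  fromℕ-pred : ∀ a → fromℕ (suc a) - 1ℚ ≡ fromℕ a
  fromℕ-pred a = trans (cong (_- 1ℚ) (fromℕ-suc a))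
    (solve 1 (λ x → con 1ℚ :+ x :- con 1ℚ := x) refl (fromℕ a))

  fromℕ-cancelˡ : ∀ d .{{_ : NonZero d}} {x y} → fromℕ d * x ≡ fromℕ d * y → x ≡ y
  fromℕ-cancelˡ d {x} {y} dx≡dy = begin
    x                          ≡⟨ expand x ⟩
    (ℤ.+ 1 / d) * (fromℕ d * x)  ≡⟨ cong ((ℤ.+ 1 / d) *_) dx≡dy ⟩
    (ℤ.+ 1 / d) * (fromℕ d * y)  ≡⟨ expand y ⟨
    y                          ∎
    where
    expand : ∀ z → z ≡ (ℤ.+ 1 / d) * (fromℕ d * z)
    expand z = begin
      z                          ≡⟨ *-identityˡ z ⟨
      1ℚ * z                     ≡⟨ cong (_* z) (/-*-cancel (ℤ.+ 1) d) ⟨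
      (ℤ.+ 1 / d) * fromℕ d * z    ≡⟨ *-assoc (ℤ.+ 1 / d) (fromℕ d) z ⟩
      (ℤ.+ 1 / d) * (fromℕ d * z)  ∎

  sum-const : ∀ n x → ∑[ i < n ] x ≡ fromℕ n * x
  sum-const zero    x = sym (*-zeroˡ x)
  sum-const (suc n) x = begin
    x + ∑[ i < n ] x    ≡⟨ cong (x +_) (sum-const n x) ⟩
    x + fromℕ n * x     ≡⟨ solve 2 (λ x n → x :+ n :* x := (con 1ℚ :+ n) :* x) refl x (fromℕ n) ⟩
    (1ℚ + fromℕ n) * x  ≡⟨ cong (_* x) (fromℕ-suc n) ⟨
    fromℕ (suc n) * x   ∎

  ∑-neg : ∀ {n} (f : Fin n → ℚ) → ∑[ i < n ] (- f i) ≡ - sum f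
  ∑-neg {n} f = begin
    ∑[ i < n ] (- f i)
      ≡⟨ sum-cong-≗ (λ i → solve 1 (λ x → :- x := con (- 1ℚ) :* x) refl (f i)) ⟩
    ∑[ i < n ] ((- 1ℚ) * f i)  ≡⟨ *-distribˡ-sum (- 1ℚ) f ⟨
    (- 1ℚ) * sum f             ≡⟨ solve 1 (λ x → con (- 1ℚ) :* x := :- x) refl (sum f) ⟩
    - sum f                    ∎

  ∑-distrib-- : ∀ {n} (f g : Fin n → ℚ) → ∑[ i < n ] (f i - g i) ≡ sum f - sum g
  ∑-distrib-- f g = trans (∑-distrib-+ f (λ i → - g i)) (cong (λ x → sum f + x) (∑-neg g))

  sum-↑ : ∀ m {k} (f : Fin (m ℕ.+ k) → ℚ) →
          sum f ≡ ∑[ i < m ] f (i ↑ˡ k) + ∑[ i < k ] f (m ↑ʳ i)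
  sum-↑ zero        f = sym (+-identityˡ (sum f))
  sum-↑ (suc m) {k} f = begin
    f zero + sum (f ∘ suc)  ≡⟨ cong (λ z → f zero + z) (sum-↑ m (f ∘ suc)) ⟩
    f zero + (∑[ i < m ] f (suc i ↑ˡ k) + ∑[ i < k ] f (suc m ↑ʳ i))
      ≡⟨ +-assoc (f zero) (∑[ i < m ] f (suc i ↑ˡ k)) (∑[ i < k ] f (suc m ↑ʳ i)) ⟨
    f zero + ∑[ i < m ] f (suc i ↑ˡ k) + ∑[ i < k ] f (suc m ↑ʳ i)  ∎

  -- `combine zero j` and `combine (suc i) j` unfold to `j ↑ˡ _` and `k ↑ʳ combine i j`, so each
  -- step peels off one block of k positions. Sums over positions become sums over servers this way.
  sum-combine : ∀ m {k} (f : Fin (m ℕ.* k) → ℚ) →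
                sum f ≡ ∑[ i < m ] ∑[ j < k ] f (combine i j)
  sum-combine zero        f = refl
  sum-combine (suc m) {k} f = begin
    sum f                                                   ≡⟨ sum-↑ k f ⟩
    ∑[ j < k ] f (j ↑ˡ (m ℕ.* k)) + ∑[ i < m ℕ.* k ] f (k ↑ʳ i)
      ≡⟨ cong (λ x → ∑[ j < k ] f (j ↑ˡ (m ℕ.* k)) + x) (sum-combine m (f ∘ (k ↑ʳ_))) ⟩
    ∑[ j < k ] f (j ↑ˡ (m ℕ.* k)) + ∑[ i < m ] ∑[ j < k ] f (k ↑ʳ combine i j)  ∎

  sum-remove′ : ∀ {n} (v : Fin (suc n) → ℚ) a → ∑[ i < n ] v (punchIn a i) ≡ sum v - v a
  sum-remove′ v a = begin
    x            ≡⟨ solve 2 (λ x y → x := y :+ x :- y) refl x (v a) ⟩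
    v a + x - v a  ≡⟨ cong (_- v a) (sum-remove {i = a} v) ⟨
    sum v - v a    ∎
    where x = ∑[ i < _ ] v (punchIn a i)

  sum-off-diagonal : ∀ n (f : Fin n → Fin n → ℚ) {A B} →
                     (∀ i → f i i ≡ A) → (∀ {i j} → i ≢ j → f i j ≡ B) →
                     ∑[ i < n ] ∑[ j < n ] f i j ≡ fromℕ n * (A + (fromℕ n - 1ℚ) * B)
  sum-off-diagonal zero    f {A} {B} diag off = sym (*-zeroˡ (A + (fromℕ 0 - 1ℚ) * B))
  sum-off-diagonal (suc n) f {A} {B} diag off =
    trans (sum-cong-≗ row) (sum-const (suc n) _)
    where
    row : ∀ i → ∑[ j < suc n ] f i j ≡ A + (fromℕ (suc n) - 1ℚ) * B
    row i = begin
      ∑[ j < suc n ] f i j                    ≡⟨ sum-remove {i = i} (f i) ⟩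
      f i i + ∑[ j < n ] f i (punchIn i j)
        ≡⟨ cong₂ _+_ (diag i) (trans (sum-cong-≗ (λ j → off (punchInᵢ≢i i j ∘ sym))) (sum-const n B)) ⟩
      A + fromℕ n * B                         ≡⟨ cong (λ x → A + x * B) (fromℕ-pred n) ⟨
      A + (fromℕ (suc n) - 1ℚ) * B            ∎

  ∑ᴸ : {A : Set} → List A → (A → ℚ) → ℚ
  ∑ᴸ []       f = 0ℚ
  ∑ᴸ (x ∷ xs) f = f x + ∑ᴸ xs f

  -- Expectations are handled as undivided sums over the listing; the division by its length appears
  -- in `mean-map` and is carried out in `𝔼Φ-formula`.
  ∑⁺ : {A : Set} → List⁺ A → (A → ℚ) → ℚ
  ∑⁺ xs = ∑ᴸ (List⁺.toList xs)

  module _ {A : Set} where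

    ∑ᴸ-cong : ∀ (xs : List A) {f g} → (∀ x → f x ≡ g x) → ∑ᴸ xs f ≡ ∑ᴸ xs g
    ∑ᴸ-cong []       f≗g = refl
    ∑ᴸ-cong (x ∷ xs) f≗g = cong₂ _+_ (f≗g x) (∑ᴸ-cong xs f≗g)

    ∑ᴸ-++ : ∀ (xs ys : List A) f → ∑ᴸ (xs ++ ys) f ≡ ∑ᴸ xs f + ∑ᴸ ys f
    ∑ᴸ-++ []       ys f = sym (+-identityˡ _)
    ∑ᴸ-++ (x ∷ xs) ys f = trans (cong (f x +_) (∑ᴸ-++ xs ys f)) (sym (+-assoc (f x) _ _))

    ∑ᴸ-*ˡ : ∀ (xs : List A) c f → ∑ᴸ xs (λ x → c * f x) ≡ c * ∑ᴸ xs f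
    ∑ᴸ-*ˡ []       c f = sym (*-zeroʳ c)
    ∑ᴸ-*ˡ (x ∷ xs) c f = trans (cong (c * f x +_) (∑ᴸ-*ˡ xs c f)) (sym (*-distribˡ-+ c (f x) _))

    ∑ᴸ-distrib-+ : ∀ (xs : List A) f g → ∑ᴸ xs (λ x → f x + g x) ≡ ∑ᴸ xs f + ∑ᴸ xs g
    ∑ᴸ-distrib-+ []       f g = refl
    ∑ᴸ-distrib-+ (x ∷ xs) f g = trans (cong (f x + g x +_) (∑ᴸ-distrib-+ xs f g))
      (solve 4 (λ a b c d → a :+ b :+ (c :+ d) := a :+ c :+ (b :+ d)) refl (f x) (g x) _ _)

    ∑ᴸ-0 : ∀ (xs : List A) → ∑ᴸ xs (λ _ → 0ℚ) ≡ 0ℚ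
    ∑ᴸ-0 []       = refl
    ∑ᴸ-0 (x ∷ xs) = trans (+-identityˡ _) (∑ᴸ-0 xs)

    ∑ᴸ-const : ∀ (xs : List A) c → ∑ᴸ xs (λ _ → c) ≡ fromℕ (List.length xs) * c
    ∑ᴸ-const []       c = sym (*-zeroˡ c)
    ∑ᴸ-const (x ∷ xs) c = begin
      c + ∑ᴸ xs (λ _ → c)               ≡⟨ cong (c +_) (∑ᴸ-const xs c) ⟩
      c + fromℕ (List.length xs) * c
        ≡⟨ solve 2 (λ x n → x :+ n :* x := (con 1ℚ :+ n) :* x) refl c (fromℕ (List.length xs)) ⟩
      (1ℚ + fromℕ (List.length xs)) * c  ≡⟨ cong (_* c) (fromℕ-suc (List.length xs)) ⟨
      fromℕ (List.length (x ∷ xs)) * c   ∎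

    ∑ᴸ-∑ : ∀ (xs : List A) n (f : A → Fin n → ℚ) →
           ∑ᴸ xs (λ x → ∑[ i < n ] f x i) ≡ ∑[ i < n ] ∑ᴸ xs (λ x → f x i)
    ∑ᴸ-∑ xs zero    f = ∑ᴸ-0 xs
    ∑ᴸ-∑ xs (suc n) f = trans
      (∑ᴸ-distrib-+ xs (λ x → f x zero) (λ x → ∑[ i < n ] f x (suc i)))
      (cong (λ z → ∑ᴸ xs (λ x → f x zero) + z) (∑ᴸ-∑ xs n (λ x → f x ∘ suc)))

  module _ {A B : Set} where

    ∑ᴸ-comm : ∀ (xs : List A) (ys : List B) (f : A → B → ℚ) →
              ∑ᴸ xs (λ x → ∑ᴸ ys (f x)) ≡ ∑ᴸ ys (λ y → ∑ᴸ xs (λ x → f x y))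
    ∑ᴸ-comm []       ys f = sym (∑ᴸ-0 ys)
    ∑ᴸ-comm (x ∷ xs) ys f = trans (cong (∑ᴸ ys (f x) +_) (∑ᴸ-comm xs ys f))
      (sym (∑ᴸ-distrib-+ ys (f x) (λ y → ∑ᴸ xs (λ x → f x y))))

    ∑ᴸ-map : ∀ (g : A → B) xs f → ∑ᴸ (List.map g xs) f ≡ ∑ᴸ xs (f ∘ g)
    ∑ᴸ-map g []       f = refl
    ∑ᴸ-map g (x ∷ xs) f = cong (f (g x) +_) (∑ᴸ-map g xs f)

    ∑⁺-concatMap : ∀ (g : A → List⁺ B) xs f → ∑⁺ (List⁺.concatMap g xs) f ≡ ∑⁺ xs (λ x → ∑⁺ (g x) f)
    ∑⁺-concatMap g (x ∷ xs) f = trans (∑ᴸ-++ (List⁺.toList (g x)) _ f) (cong (∑⁺ (g x) f +_) (go xs))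
      where
      go : ∀ xs → ∑ᴸ (List.concat (List.map List⁺.toList (List.map g xs))) f ≡ ∑ᴸ xs (λ x → ∑⁺ (g x) f)
      go []       = refl
      go (x ∷ xs) = trans (∑ᴸ-++ (List⁺.toList (g x)) _ f) (cong (∑⁺ (g x) f +_) (go xs))

  ∑ᴸ-tabulate : ∀ {A : Set} n (g : Fin n → A) f → ∑ᴸ (List.tabulate g) f ≡ ∑[ i < n ] f (g i)
  ∑ᴸ-tabulate zero    g f = refl
  ∑ᴸ-tabulate (suc n) g f = cong (f (g zero) +_) (∑ᴸ-tabulate n (g ∘ suc) f)

  mean-map : ∀ {A : Set} (f : A → ℚ) xs →
             mean (List⁺.map f xs) ≡ ∑⁺ xs f * (ℤ.+ 1 / List⁺.length xs)
  mean-map f (x ∷ xs) = cong₂ (λ y l → y * (ℤ.+ 1 / suc l)) (go x xs) (List.length-map f xs)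
    where
    go : ∀ x xs → List⁺.foldr₁ _+_ (List⁺.map f (x ∷ xs)) ≡ ∑⁺ (x ∷ xs) f
    go x []       = sym (+-identityʳ (f x))
    go x (y ∷ xs) = cong (f x +_) (go y xs)

-- Sums over all permutations

module _ where
  open import Data.Rational.Base using (_*_; _≤_)
  open ≡-Reasoning

  Σπ : ∀ n → (Permutation′ n → ℚ) → ℚ
  Σπ n = ∑⁺ (permutations n)

  #π : ℕ → ℚ
  #π n = fromℕ (List⁺.length (permutations n))

  -- Conditioning on the image j of `zero`: the rest of the permutation is an arbitrary ρ on one
  -- point fewer.
  Σπ-suc : ∀ n f → Σπ (suc n) f ≡ ∑[ j < suc n ] Σπ n (λ ρ → f (insert zero j ρ))
  Σπ-suc n f = trans
    (∑⁺-concatMap (λ j → List⁺.map (insert zero j) (permutations n)) (zero ∷ List.tabulate suc) f)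
    (cong₂ _+_ (step zero) (trans (∑ᴸ-tabulate n suc _) (sum-cong-≗ (step ∘ suc))))
    where
    step : ∀ j → ∑⁺ (List⁺.map (insert zero j) (permutations n)) f ≡ Σπ n (λ ρ → f (insert zero j ρ))
    step j = ∑ᴸ-map (insert zero j) (List⁺.toList (permutations n)) f

  Σπ-const : ∀ n c → Σπ n (λ _ → c) ≡ #π n * c
  Σπ-const n c = ∑ᴸ-const (List⁺.toList (permutations n)) c

  Σπ-cong : ∀ n {f g : Permutation′ n → ℚ} → (∀ π → f π ≡ g π) → Σπ n f ≡ Σπ n g
  Σπ-cong n = ∑ᴸ-cong (List⁺.toList (permutations n))

  Σπ-*ˡ : ∀ n c f → Σπ n (λ π → c * f π) ≡ c * Σπ n f
  Σπ-*ˡ n = ∑ᴸ-*ˡ (List⁺.toList (permutations n))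

  -- Counting is summing 1, so `Σπ-suc` yields the recursion of the factorial.
  #π-suc : ∀ n → #π (suc n) ≡ fromℕ (suc n) * #π n
  #π-suc n = begin
    #π (suc n)                               ≡⟨ *-identityʳ (#π (suc n)) ⟨
    #π (suc n) * 1ℚ                          ≡⟨ Σπ-const (suc n) 1ℚ ⟨
    Σπ (suc n) (λ _ → 1ℚ)                    ≡⟨ Σπ-suc n (λ _ → 1ℚ) ⟩
    ∑[ j < suc n ] Σπ n (λ _ → 1ℚ)           ≡⟨ sum-const (suc n) _ ⟩
    fromℕ (suc n) * Σπ n (λ _ → 1ℚ)
      ≡⟨ cong (fromℕ (suc n) *_) (trans (Σπ-const n 1ℚ) (*-identityʳ (#π n))) ⟩
    fromℕ (suc n) * #π n                     ∎

  -- The common end of the induction steps: the factor `fromℕ (suc n)` is exactly the growth of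
  -- `#π`.
  Σπ-scale : ∀ n f {y} → ∑[ a < suc n ] Σπ n (λ ρ → f (insert zero a ρ)) ≡ #π n * y →
             fromℕ (suc n) * Σπ (suc n) f ≡ #π (suc n) * y
  Σπ-scale n f {y} eq = begin
    fromℕ (suc n) * Σπ (suc n) f  ≡⟨ cong (fromℕ (suc n) *_) (trans (Σπ-suc n f) eq) ⟩
    fromℕ (suc n) * (#π n * y)    ≡⟨ *-assoc (fromℕ (suc n)) (#π n) y ⟨
    fromℕ (suc n) * #π n * y      ≡⟨ cong (_* y) (#π-suc n) ⟨
    #π (suc n) * y                ∎

  -- Induction through the image a of `zero`. Given a, position `suc i` receives a uniform entry of
  -- v other than v a, so n times the inner sum is `#π n * (sum v - v a)`. Over the n + 1 values of
  -- a each entry is left out once, which leaves n times `sum v`.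
  Σπ-single : ∀ n (v : Fin n → ℚ) i → fromℕ n * Σπ n (λ π → v (π ⟨$⟩ʳ i)) ≡ #π n * sum v
  Σπ-single (suc n) v zero = Σπ-scale n (λ π → v (π ⟨$⟩ʳ zero)) $
    trans (sum-cong-≗ (λ a → Σπ-const n (v a))) (sym (*-distribˡ-sum (#π n) v))
  Σπ-single (suc n@(suc _)) v (suc i) = Σπ-scale n (λ π → v (π ⟨$⟩ʳ suc i)) $ fromℕ-cancelˡ n $ begin
    fromℕ n * ∑[ a < suc n ] X a           ≡⟨ *-distribˡ-sum (fromℕ n) X ⟩
    ∑[ a < suc n ] (fromℕ n * X a)         ≡⟨ sum-cong-≗ step ⟩
    ∑[ a < suc n ] (#π n * (sum v - v a))  ≡⟨ *-distribˡ-sum (#π n) (λ a → sum v - v a) ⟨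
    #π n * ∑[ a < suc n ] (sum v - v a)    ≡⟨ cong (#π n *_) (∑-distrib-- (λ _ → sum v) v) ⟩
    #π n * (∑[ a < suc n ] sum v - sum v)
      ≡⟨ cong (λ z → #π n * (z - sum v)) (trans (sum-const (suc n) (sum v)) (cong (_* sum v) (fromℕ-suc n))) ⟩
    #π n * ((1ℚ + fromℕ n) * sum v - sum v)
      ≡⟨ solve 3 (λ p n s → p :* ((con 1ℚ :+ n) :* s :- s) := n :* (p :* s))
               refl (#π n) (fromℕ n) (sum v) ⟩
    fromℕ n * (#π n * sum v)               ∎
    where
    X : Fin (suc n) → ℚ
    X a = Σπ n (λ ρ → v (insert zero a ρ ⟨$⟩ʳ suc i))
    step : ∀ a → fromℕ n * X a ≡ #π n * (sum v - v a)
    step a = begin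
      fromℕ n * X a
        ≡⟨ cong (fromℕ n *_) (Σπ-cong n (λ ρ → cong v (insert-punchIn zero a ρ i))) ⟩
      fromℕ n * Σπ n (λ ρ → v (punchIn a (ρ ⟨$⟩ʳ i)))  ≡⟨ Σπ-single n (v ∘ punchIn a) i ⟩
      #π n * sum (v ∘ punchIn a)                       ≡⟨ cong (#π n *_) (sum-remove′ v a) ⟩
      #π n * (sum v - v a)                             ∎

  -- Pairs of distinct entries

  sumSq : ∀ {n} → (Fin n → ℚ) → ℚ
  sumSq {n} v = ∑[ i < n ] (v i * v i)

  -- The sum of v a * v b over all ordered pairs a ≠ b.
  offDiagonal : ∀ {n} → (Fin n → ℚ) → ℚ
  offDiagonal v = sum v * sum v - sumSq v

  sum-offDiagonal : ∀ {n} (v : Fin (suc n) → ℚ) →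
                    ∑[ a < suc n ] (v a * (sum v - v a)) ≡ offDiagonal v
  sum-offDiagonal {n} v = begin
    ∑[ a < suc n ] (v a * (sum v - v a))
      ≡⟨ sum-cong-≗ (λ a → solve 2 (λ x t → x :* (t :- x) := t :* x :- x :* x) refl (v a) (sum v)) ⟩
    ∑[ a < suc n ] (sum v * v a - v a * v a)
      ≡⟨ ∑-distrib-- (λ a → sum v * v a) (λ a → v a * v a) ⟩
    ∑[ a < suc n ] (sum v * v a) - sumSq v
      ≡⟨ cong (_- sumSq v) (*-distribˡ-sum (sum v) v) ⟨
    offDiagonal v ∎

  -- Deleting entry a loses the pairs with a in first place and, equally, those with a in second
  -- place.
  offDiagonal-remove : ∀ {n} (v : Fin (suc n) → ℚ) a →
                       offDiagonal (v ∘ punchIn a) ≡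
                       offDiagonal v - (v a * (sum v - v a) + v a * (sum v - v a))
  offDiagonal-remove v a = begin
    offDiagonal (v ∘ punchIn a)
      ≡⟨ cong₂ (λ x y → x * x - y) (sum-remove′ v a) (sum-remove′ (λ i → v i * v i) a) ⟩
    (sum v - v a) * (sum v - v a) - (sumSq v - v a * v a)
      ≡⟨ solve 3 (λ t x q → (t :- x) :* (t :- x) :- (q :- x :* x) :=
                     t :* t :- q :- (x :* (t :- x) :+ x :* (t :- x)))
               refl (sum v) (v a) (sumSq v) ⟩
    offDiagonal v - (v a * (sum v - v a) + v a * (sum v - v a)) ∎

  -- A pair of distinct entries survives the deletion of a for n - 1 of the n + 1 values of a.
  sum-offDiagonal-remove : ∀ {n} (v : Fin (suc n) → ℚ) →
    ∑[ a < suc n ] offDiagonal (v ∘ punchIn a) ≡ (fromℕ n - 1ℚ) * offDiagonal v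
  sum-offDiagonal-remove {n} v = begin
    ∑[ a < suc n ] offDiagonal (v ∘ punchIn a)
      ≡⟨ sum-cong-≗ (offDiagonal-remove v) ⟩
    ∑[ a < suc n ] (D - (x a + x a))
      ≡⟨ ∑-distrib-- (λ _ → D) (λ a → x a + x a) ⟩
    ∑[ a < suc n ] D - ∑[ a < suc n ] (x a + x a)
      ≡⟨ cong₂ _-_ (trans (sum-const (suc n) D) (cong (_* D) (fromℕ-suc n)))
                   (trans (∑-distrib-+ x x) (cong₂ _+_ (sum-offDiagonal v) (sum-offDiagonal v))) ⟩
    (1ℚ + fromℕ n) * D - (D + D)
      ≡⟨ solve 2 (λ n d → (con 1ℚ :+ n) :* d :- (d :+ d) := (n :- con 1ℚ) :* d) refl (fromℕ n) D ⟩
    (fromℕ n - 1ℚ) * D ∎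
    where
    D = offDiagonal v
    x : Fin (suc n) → ℚ
    x a = v a * (sum v - v a)

  -- `Σπ-scale` for two positions: the second factor, n, stays inside the sum, where the inner
  -- average over ρ needs it.
  Σπ-scale₂ : ∀ n f {y} → ∑[ a < suc n ] (fromℕ n * Σπ n (λ ρ → f (insert zero a ρ))) ≡ #π n * y →
              fromℕ (suc n) * ((fromℕ (suc n) - 1ℚ) * Σπ (suc n) f) ≡ #π (suc n) * y
  Σπ-scale₂ n f {y} eq = begin
    fromℕ (suc n) * ((fromℕ (suc n) - 1ℚ) * Σπ (suc n) f)
      ≡⟨ cong (λ c → fromℕ (suc n) * (c * Σπ (suc n) f)) (fromℕ-pred n) ⟩
    fromℕ (suc n) * (fromℕ n * Σπ (suc n) f)
      ≡⟨ cong (fromℕ (suc n) *_) (Σπ-*ˡ (suc n) (fromℕ n) f) ⟨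
    fromℕ (suc n) * Σπ (suc n) (λ π → fromℕ n * f π)
      ≡⟨ Σπ-scale n (λ π → fromℕ n * f π)
           (trans (sum-cong-≗ (λ a → Σπ-*ˡ n (fromℕ n) (λ ρ → f (insert zero a ρ)))) eq) ⟩
    #π (suc n) * y ∎

  -- If one index is `zero`, its image a gives one factor and `Σπ-single` on the entries other than
  -- a gives the other. If neither is, both positions are governed by ρ, and the induction
  -- hypothesis for v without v a is summed over a by `sum-offDiagonal-remove`.
  Σπ-pair : ∀ n (v : Fin n → ℚ) {i j} → i ≢ j →
            fromℕ n * ((fromℕ n - 1ℚ) * Σπ n (λ π → v (π ⟨$⟩ʳ i) * v (π ⟨$⟩ʳ j))) ≡ #π n * offDiagonal v
  Σπ-pair (suc n) v {zero}  {zero}  i≢j = contradiction refl i≢j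
  Σπ-pair (suc n) v {suc i} {zero}  i≢j = trans
    (cong (λ z → fromℕ (suc n) * ((fromℕ (suc n) - 1ℚ) * z))
          (Σπ-cong (suc n) (λ π → *-comm (v (π ⟨$⟩ʳ suc i)) (v (π ⟨$⟩ʳ zero)))))
    (Σπ-pair (suc n) v {zero} {suc i} (i≢j ∘ sym))
  Σπ-pair (suc n) v {zero}  {suc j} i≢j =
    Σπ-scale₂ n (λ π → v (π ⟨$⟩ʳ zero) * v (π ⟨$⟩ʳ suc j)) $ begin
    ∑[ a < suc n ] (fromℕ n * Σπ n (λ ρ → v a * v (insert zero a ρ ⟨$⟩ʳ suc j)))
      ≡⟨ sum-cong-≗ step ⟩
    ∑[ a < suc n ] (#π n * (v a * (sum v - v a)))
      ≡⟨ *-distribˡ-sum (#π n) (λ a → v a * (sum v - v a)) ⟨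
    #π n * ∑[ a < suc n ] (v a * (sum v - v a))
      ≡⟨ cong (#π n *_) (sum-offDiagonal v) ⟩
    #π n * offDiagonal v ∎
    where
    step : ∀ a → fromℕ n * Σπ n (λ ρ → v a * v (insert zero a ρ ⟨$⟩ʳ suc j)) ≡ #π n * (v a * (sum v - v a))
    step a = begin
      fromℕ n * Σπ n (λ ρ → v a * v (insert zero a ρ ⟨$⟩ʳ suc j))
        ≡⟨ cong (fromℕ n *_) (Σπ-cong n (λ ρ → cong (λ b → v a * v b) (insert-punchIn zero a ρ j))) ⟩
      fromℕ n * Σπ n (λ ρ → v a * v (punchIn a (ρ ⟨$⟩ʳ j)))
        ≡⟨ cong (fromℕ n *_) (Σπ-*ˡ n (v a) (λ ρ → v (punchIn a (ρ ⟨$⟩ʳ j)))) ⟩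
      fromℕ n * (v a * Y)
        ≡⟨ solve 3 (λ n x y → n :* (x :* y) := x :* (n :* y)) refl (fromℕ n) (v a) Y ⟩
      v a * (fromℕ n * Y)
        ≡⟨ cong (v a *_) (trans (Σπ-single n (v ∘ punchIn a) j) (cong (#π n *_) (sum-remove′ v a))) ⟩
      v a * (#π n * (sum v - v a))
        ≡⟨ solve 3 (λ n x y → x :* (n :* y) := n :* (x :* y)) refl (#π n) (v a) (sum v - v a) ⟩
      #π n * (v a * (sum v - v a)) ∎
      where Y = Σπ n (λ ρ → v (punchIn a (ρ ⟨$⟩ʳ j)))
  -- With two positions the only successor index is `suc zero`. Excluding this case makes `n-1`
  -- positive below, so that it can be cancelled.
  Σπ-pair (suc (suc zero)) v {suc zero} {suc zero} i≢j = contradiction refl i≢j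
  Σπ-pair (suc n@(suc n-1@(suc _))) v {suc i} {suc j} i≢j =
    Σπ-scale₂ n f $ fromℕ-cancelˡ n-1 $ begin
    fromℕ n-1 * ∑[ a < suc n ] (fromℕ n * X a)
      ≡⟨ cong (_* ∑[ a < suc n ] (fromℕ n * X a)) (fromℕ-pred n-1) ⟨
    (fromℕ n - 1ℚ) * ∑[ a < suc n ] (fromℕ n * X a)
      ≡⟨ *-distribˡ-sum (fromℕ n - 1ℚ) (λ a → fromℕ n * X a) ⟩
    ∑[ a < suc n ] ((fromℕ n - 1ℚ) * (fromℕ n * X a))
      ≡⟨ sum-cong-≗ step ⟩
    ∑[ a < suc n ] (#π n * offDiagonal (v ∘ punchIn a))
      ≡⟨ *-distribˡ-sum (#π n) (λ a → offDiagonal (v ∘ punchIn a)) ⟨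
    #π n * ∑[ a < suc n ] (offDiagonal (v ∘ punchIn a))
      ≡⟨ cong (#π n *_) (trans (sum-offDiagonal-remove v) (cong (_* offDiagonal v) (fromℕ-pred n-1))) ⟩
    #π n * (fromℕ n-1 * offDiagonal v)
      ≡⟨ solve 3 (λ p n d → p :* (n :* d) := n :* (p :* d)) refl (#π n) (fromℕ n-1) (offDiagonal v) ⟩
    fromℕ n-1 * (#π n * offDiagonal v) ∎
    where
    f : Permutation′ (suc n) → ℚ
    f π = v (π ⟨$⟩ʳ suc i) * v (π ⟨$⟩ʳ suc j)
    X : Fin (suc n) → ℚ
    X a = Σπ n (λ ρ → f (insert zero a ρ))
    step : ∀ a → (fromℕ n - 1ℚ) * (fromℕ n * X a) ≡ #π n * offDiagonal (v ∘ punchIn a)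
    step a = begin
      (fromℕ n - 1ℚ) * (fromℕ n * X a)
        ≡⟨ solve 3 (λ m n x → m :* (n :* x) := n :* (m :* x)) refl (fromℕ n - 1ℚ) (fromℕ n) (X a) ⟩
      fromℕ n * ((fromℕ n - 1ℚ) * X a)
        ≡⟨ cong (λ z → fromℕ n * ((fromℕ n - 1ℚ) * z))
             (Σπ-cong n (λ ρ → cong₂ (λ b c → v b * v c) (insert-punchIn zero a ρ i) (insert-punchIn zero a ρ j))) ⟩
      fromℕ n * ((fromℕ n - 1ℚ) * Σπ n (λ ρ → v (punchIn a (ρ ⟨$⟩ʳ i)) * v (punchIn a (ρ ⟨$⟩ʳ j))))
        ≡⟨ Σπ-pair n (v ∘ punchIn a) (i≢j ∘ cong suc) ⟩
      #π n * offDiagonal (v ∘ punchIn a) ∎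

-- One round

module _ where
  open import Data.Rational.Base using (_*_; _≤_)
  open ≡-Reasoning

  indicator : Bool → ℚ
  indicator b = if b then 1ℚ else 0ℚ

  sum-indicator : ∀ {m} (S : Subset m) → ∑[ j < m ] indicator (lookup S j) ≡ fromℕ ∣ S ∣
  sum-indicator []            = refl
  sum-indicator (inside  ∷ S) = trans (cong (1ℚ +_) (sum-indicator S)) (sym (fromℕ-suc ∣ S ∣))
  sum-indicator (outside ∷ S) = trans (+-identityˡ _) (sum-indicator S)

  sum-*-sum : ∀ {m k} (f : Fin m → ℚ) (g : Fin k → ℚ) →
              sum f * sum g ≡ ∑[ i < m ] ∑[ j < k ] (f i * g j)
  sum-*-sum f g = trans (*-distribʳ-sum (sum g) f) (sum-cong-≗ (λ i → *-distribˡ-sum (f i) g))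

  module _ (K : ℕ) .{{_ : NonZero K}} where

    -- `mix` on a single block, with positions relative to the block and the server's status reduced
    -- to a Boolean.
    serve : Bool → (Fin K → ℚ) → Fin K → ℚ
    serve b x k = if b then sum x * (ℤ.+ 1 / K) else x k

    sum-serve : ∀ b x → sum (serve b x) ≡ sum x
    sum-serve false x = refl
    sum-serve true  x = begin
      ∑[ k < K ] (sum x * (ℤ.+ 1 / K))      ≡⟨ sum-const K _ ⟩
      fromℕ K * (sum x * (ℤ.+ 1 / K))
        ≡⟨ solve 3 (λ a b c → a :* (b :* c) := (c :* a) :* b) refl (fromℕ K) (sum x) (ℤ.+ 1 / K) ⟩
      (ℤ.+ 1 / K) * fromℕ K * sum x         ≡⟨ cong (_* sum x) (/-*-cancel (ℤ.+ 1) K) ⟩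
      1ℚ * sum x                            ≡⟨ *-identityˡ (sum x) ⟩
      sum x                                 ∎

    -- K equal squares (sum x / K)² add up to (sum x)² / K; expanded into products, this needs only
    -- the moments of one and of two positions.
    sumSq-average : ∀ x → sumSq (serve true x) ≡ (ℤ.+ 1 / K) * ∑[ k < K ] ∑[ l < K ] (x k * x l)
    sumSq-average x = begin
      ∑[ k < K ] (sum x * h * (sum x * h))      ≡⟨ sum-const K _ ⟩
      fromℕ K * (sum x * h * (sum x * h))
        ≡⟨ solve 3 (λ a b c → a :* (b :* c :* (b :* c)) := (c :* a) :* (c :* (b :* b)))
                 refl (fromℕ K) (sum x) h ⟩
      h * fromℕ K * (h * (sum x * sum x))
        ≡⟨ cong (_* (h * (sum x * sum x))) (/-*-cancel (ℤ.+ 1) K) ⟩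
      1ℚ * (h * (sum x * sum x))                  ≡⟨ *-identityˡ _ ⟩
      h * (sum x * sum x)                         ≡⟨ cong (h *_) (sum-*-sum x x) ⟩
      h * ∑[ k < K ] ∑[ l < K ] (x k * x l)       ∎
      where h = ℤ.+ 1 / K

    -- A block left unchanged contributes K A. An averaged block contributes (1 / K) (K A + K (K -
    -- 1) B) = A + (K - 1) B, which is K A less (K - 1) (A - B). The indicator merges the two cases
    -- into a formula that can be summed over the servers.
    Σπ-sumSq-serve : ∀ {n} (v : Fin n → ℚ) {A B} →
      (∀ i → Σπ n (λ π → v (π ⟨$⟩ʳ i) * v (π ⟨$⟩ʳ i)) ≡ A) →
      (∀ {i j} → i ≢ j → Σπ n (λ π → v (π ⟨$⟩ʳ i) * v (π ⟨$⟩ʳ j)) ≡ B) →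
      (c : Fin K → Fin n) → (∀ {k l} → c k ≡ c l → k ≡ l) → ∀ b →
      Σπ n (λ π → sumSq (serve b (λ k → v (π ⟨$⟩ʳ c k)))) ≡
      fromℕ K * A - indicator b * ((fromℕ K - 1ℚ) * (A - B))
    Σπ-sumSq-serve {n} v {A} {B} single pair c c-inj false = begin
      Σπ n (λ π → ∑[ k < K ] (v (π ⟨$⟩ʳ c k) * v (π ⟨$⟩ʳ c k)))
        ≡⟨ ∑ᴸ-∑ (List⁺.toList (permutations n)) K (λ π k → v (π ⟨$⟩ʳ c k) * v (π ⟨$⟩ʳ c k)) ⟩
      ∑[ k < K ] Σπ n (λ π → v (π ⟨$⟩ʳ c k) * v (π ⟨$⟩ʳ c k))
        ≡⟨ trans (sum-cong-≗ (single ∘ c)) (sum-const K A) ⟩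
      fromℕ K * A
        ≡⟨ solve 2 (λ a b → a := a :- con 0ℚ :* b) refl (fromℕ K * A) ((fromℕ K - 1ℚ) * (A - B)) ⟩
      fromℕ K * A - 0ℚ * ((fromℕ K - 1ℚ) * (A - B)) ∎
    Σπ-sumSq-serve {n} v {A} {B} single pair c c-inj true = begin
      Σπ n (λ π → sumSq (serve true (λ k → v (π ⟨$⟩ʳ c k))))
        ≡⟨ Σπ-cong n (λ π → sumSq-average (λ k → v (π ⟨$⟩ʳ c k))) ⟩
      Σπ n (λ π → h * ∑[ k < K ] ∑[ l < K ] F k l π)
        ≡⟨ Σπ-*ˡ n h (λ π → ∑[ k < K ] ∑[ l < K ] F k l π) ⟩
      h * Σπ n (λ π → ∑[ k < K ] ∑[ l < K ] F k l π)
        ≡⟨ cong (h *_) (trans (∑ᴸ-∑ Π K (λ π k → ∑[ l < K ] F k l π))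
                              (sum-cong-≗ (λ k → ∑ᴸ-∑ Π K (λ π l → F k l π)))) ⟩
      h * ∑[ k < K ] ∑[ l < K ] Σπ n (F k l)
        ≡⟨ cong (h *_) (sum-off-diagonal K (λ k l → Σπ n (F k l)) (single ∘ c) (λ k≢l → pair (k≢l ∘ c-inj))) ⟩
      h * (fromℕ K * (A + (fromℕ K - 1ℚ) * B))
        ≡⟨ *-assoc h (fromℕ K) _ ⟨
      h * fromℕ K * (A + (fromℕ K - 1ℚ) * B)
        ≡⟨ cong (_* (A + (fromℕ K - 1ℚ) * B)) (/-*-cancel (ℤ.+ 1) K) ⟩
      1ℚ * (A + (fromℕ K - 1ℚ) * B)
        ≡⟨ solve 3 (λ k a b → con 1ℚ :* (a :+ (k :- con 1ℚ) :* b) :=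
                       k :* a :- con 1ℚ :* ((k :- con 1ℚ) :* (a :- b)))
                 refl (fromℕ K) A B ⟩
      fromℕ K * A - 1ℚ * ((fromℕ K - 1ℚ) * (A - B)) ∎
      where
      h = ℤ.+ 1 / K
      Π = List⁺.toList (permutations n)
      F : Fin K → Fin K → Permutation′ n → ℚ
      F k l π = v (π ⟨$⟩ʳ c k) * v (π ⟨$⟩ʳ c l)

  -- `w []` for an arbitrary number of positions: the n of the mixnet is a product, which does not
  -- expose its first position.
  unit : ∀ {n} → Fin n → ℚ
  unit i = if does (toℕ i ℕ.≟ 0) then 1ℚ else 0ℚ

  sum-unit : ∀ n .{{_ : NonZero n}} → sum {n} unit ≡ 1ℚ
  sum-unit (suc n) = cong (1ℚ +_) (trans (sum-const n 0ℚ) (*-zeroʳ (fromℕ n)))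

  sumSq-unit : ∀ n .{{_ : NonZero n}} → sumSq {n} unit ≡ 1ℚ
  sumSq-unit (suc n) = cong (1ℚ +_) (trans (sum-const n 0ℚ) (*-zeroʳ (fromℕ n)))

  -- Here total mass 1 turns a difference of moments into the potential: A = N Q / n and B = N (1 -
  -- Q) / (n (n - 1)) differ by N (n Q - 1) / (n (n - 1)). The term `1ℚ * 1ℚ` is the squared mass
  -- inside `offDiagonal`.
  offDiagonal-gap : ∀ n .{{_ : NonZero n}} {N Q A B e} →
    (fromℕ n - 1ℚ) * e ≡ 1ℚ → fromℕ n * A ≡ N * Q →
    fromℕ n * ((fromℕ n - 1ℚ) * B) ≡ N * (1ℚ * 1ℚ - Q) →
    A - B ≡ N * (Q - (ℤ.+ 1 / n)) * e
  offDiagonal-gap n {N} {Q} {A} {B} {e} inv single pair = begin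
    A - B
      ≡⟨ solve 2 (λ a b → a :- b := con 1ℚ :* (con 1ℚ :* a :- con 1ℚ :* b)) refl A B ⟩
    1ℚ * (1ℚ * A - 1ℚ * B)
      ≡⟨ cong₂ (λ x y → x * (y * A - y * B)) (sym (/-*-cancel (ℤ.+ 1) n)) (sym inv) ⟩
    h * n′ * ((n′ - 1ℚ) * e * A - (n′ - 1ℚ) * e * B)
      ≡⟨ solve 5 (λ h n e a b → h :* n :* ((n :- con 1ℚ) :* e :* a :- (n :- con 1ℚ) :* e :* b) :=
                                h :* e :* ((n :- con 1ℚ) :* (n :* a) :- n :* ((n :- con 1ℚ) :* b)))
                                         refl h n′ e A B ⟩
    h * e * ((n′ - 1ℚ) * (n′ * A) - n′ * ((n′ - 1ℚ) * B))
      ≡⟨ cong₂ (λ x y → h * e * ((n′ - 1ℚ) * x - y)) single pair ⟩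
    h * e * ((n′ - 1ℚ) * (N * Q) - N * (1ℚ * 1ℚ - Q))
      ≡⟨ solve 5 (λ h n e N q → h :* e :* ((n :- con 1ℚ) :* (N :* q) :- N :* (con 1ℚ :* con 1ℚ :- q)) :=
                                N :* (h :* n :* q :- h) :* e) refl h n′ e N Q ⟩
    N * (h * n′ * Q - h) * e
      ≡⟨ cong (λ x → N * (x * Q - h) * e) (/-*-cancel (ℤ.+ 1) n) ⟩
    N * (1ℚ * Q - h) * e
      ≡⟨ cong (λ x → N * (x - h) * e) (*-identityˡ Q) ⟩
    N * (Q - h) * e ∎
    where
    h = ℤ.+ 1 / n
    n′ = fromℕ n

  -- Contraction of the potential in one round

  module MixnetProperties (K M : ℕ) .{{_ : NonTrivial K}} .{{_ : NonZero M}} (S : Subset M) where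
    open Mixnet K M S

    mix-combine : ∀ v j k → mix v (combine j k) ≡ serve K (lookup S j) (λ l → v (combine j l)) k
    mix-combine v j k = cong
      (λ i → if lookup S i then (∑[ l < K ] v (combine i l)) * (ℤ.+ 1 / K) else v (combine j k))
      (cong proj₁ (remQuot-combine j k))

    sum-mix : ∀ v → sum (mix v) ≡ sum v
    sum-mix v = begin
      sum (mix v)                                  ≡⟨ sum-combine M (mix v) ⟩
      ∑[ j < M ] ∑[ k < K ] mix v (combine j k)
        ≡⟨ sum-cong-≗ (λ j → trans (sum-cong-≗ (mix-combine v j)) (sum-serve K (lookup S j) (λ k → v (combine j k)))) ⟩
      ∑[ j < M ] ∑[ k < K ] v (combine j k)        ≡⟨ sum-combine M v ⟨
      sum v                                        ∎

    sum-w : ∀ {t} (πs : Vec (Permutation′ n) t) → sum (w πs) ≡ 1ℚ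
    sum-w []       = sum-unit n
    sum-w (π ∷ πs) = trans (sum-mix (λ i → w πs (π ⟨$⟩ʳ i))) (trans (sym (sum-permute (w πs) π)) (sum-w πs))

    n>1 : 1 ℕ.< n
    n>1 = ℕ.<-≤-trans (ℕ.nonTrivial⇒n>1 K) (ℕ.m≤n*m K M)

    instance
      n-1≢0 : NonZero (n ℕ.∸ 1)
      n-1≢0 = ℕ.>-nonZero (ℕ.m<n⇒0<n∸m n>1)

    e ρ : ℚ
    e = ℤ.+ 1 / (n ℕ.∸ 1)
    ρ = 1ℚ - fromℕ ∣ S ∣ * ((fromℕ K - 1ℚ) * e)

    fromℕ-∸1 : ∀ m .{{_ : NonZero m}} → fromℕ (m ℕ.∸ 1) ≡ fromℕ m - 1ℚ
    fromℕ-∸1 (suc m) = sym (fromℕ-pred m)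

    e-inverse : (fromℕ n - 1ℚ) * e ≡ 1ℚ
    e-inverse = begin
      (fromℕ n - 1ℚ) * e   ≡⟨ *-comm _ e ⟩
      e * (fromℕ n - 1ℚ)   ≡⟨ cong (e *_) (fromℕ-∸1 n) ⟨
      e * fromℕ (n ℕ.∸ 1)  ≡⟨ /-*-cancel (ℤ.+ 1) (n ℕ.∸ 1) ⟩
      1ℚ                   ∎

    -- Without averaging the sum of squares is kept, n A = `#π n` Q; each averaging server subtracts
    -- (K - 1) (A - B), which by `gap` is a multiple of the current potential. The factor `ρ` is
    -- therefore the same for every past `πs`.
    Σπ-Φ : ∀ {t} (πs : Vec (Permutation′ n) t) → Σπ n (λ π → Φ (π ∷ πs)) ≡ #π n * (ρ * Φ πs)
    Σπ-Φ πs = begin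
      Σπ n (λ π → Φ (π ∷ πs))
        ≡⟨ ∑ᴸ-distrib-+ Π (λ π → sumSq (round π v)) (λ _ → - h) ⟩
      Σπ n (λ π → sumSq (round π v)) + Σπ n (λ _ → - h)
        ≡⟨ cong₂ _+_ total (Σπ-const n (- h)) ⟩
      fromℕ n * A - fromℕ ∣ S ∣ * ((fromℕ K - 1ℚ) * (A - B)) + #π n * (- h)
        ≡⟨ cong₂ (λ x y → x - fromℕ ∣ S ∣ * ((fromℕ K - 1ℚ) * y) + #π n * (- h)) nA gap ⟩
      #π n * Q - fromℕ ∣ S ∣ * ((fromℕ K - 1ℚ) * (#π n * (Q - h) * e)) + #π n * (- h)
        ≡⟨ solve 6 (λ N q s k h e → N :* q :- s :* (k :* (N :* (q :- h) :* e)) :+ N :* (:- h) :=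
                                    N :* ((con 1ℚ :- s :* (k :* e)) :* (q :- h)))
                 refl (#π n) Q (fromℕ ∣ S ∣) (fromℕ K - 1ℚ) h e ⟩
      #π n * (ρ * Φ πs) ∎
      where
      Π = List⁺.toList (permutations n)
      v = w πs
      h = ℤ.+ 1 / n
      Q = sumSq v
      -- The diagonal and off-diagonal moments in closed form, with 1 / n = `h` and 1 / (n - 1) =
      -- `e`; `single` and `pair` confirm that they do not depend on the positions.
      A B : ℚ
      A = #π n * Q * h
      B = #π n * offDiagonal v * h * e
      cancel : ∀ y → fromℕ n * (y * h) ≡ y
      cancel y = begin
        fromℕ n * (y * h)  ≡⟨ solve 3 (λ n y h → n :* (y :* h) := h :* n :* y) refl (fromℕ n) y h ⟩
        h * fromℕ n * y    ≡⟨ cong (_* y) (/-*-cancel (ℤ.+ 1) n) ⟩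
        1ℚ * y             ≡⟨ *-identityˡ y ⟩
        y                  ∎
      nA : fromℕ n * A ≡ #π n * Q
      nA = cancel (#π n * Q)
      nB : fromℕ n * ((fromℕ n - 1ℚ) * B) ≡ #π n * offDiagonal v
      nB = begin
        fromℕ n * ((fromℕ n - 1ℚ) * (y * h * e))
          ≡⟨ solve 4 (λ n y h e → n :* ((n :- con 1ℚ) :* (y :* h :* e)) :=
                         (n :- con 1ℚ) :* e :* (n :* (y :* h)))
                   refl (fromℕ n) y h e ⟩
        (fromℕ n - 1ℚ) * e * (fromℕ n * (y * h))  ≡⟨ cong₂ _*_ e-inverse (cancel y) ⟩
        1ℚ * y  ≡⟨ *-identityˡ y ⟩
        y ∎
        where y = #π n * offDiagonal v
      gap : A - B ≡ #π n * (Q - h) * e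
      gap = offDiagonal-gap n {#π n} {Q} {A} {B} {e} e-inverse nA
        (trans nB (cong (λ x → #π n * (x * x - Q)) (sum-w πs)))
      single : ∀ i → Σπ n (λ π → v (π ⟨$⟩ʳ i) * v (π ⟨$⟩ʳ i)) ≡ A
      single i = fromℕ-cancelˡ n (trans (Σπ-single n (λ a → v a * v a) i) (sym nA))
      pair : ∀ {i j} → i ≢ j → Σπ n (λ π → v (π ⟨$⟩ʳ i) * v (π ⟨$⟩ʳ j)) ≡ B
      pair {i} {j} i≢j = begin
        X                                         ≡⟨ *-identityˡ X ⟨
        1ℚ * X                                    ≡⟨ cong (_* X) e-inverse ⟨
        (fromℕ n - 1ℚ) * e * X
          ≡⟨ solve 3 (λ m e x → m :* e :* x := e :* (m :* x)) refl (fromℕ n - 1ℚ) e X ⟩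
        e * ((fromℕ n - 1ℚ) * X)
          ≡⟨ cong (e *_) (fromℕ-cancelˡ n (trans (Σπ-pair n v i≢j) (sym nB))) ⟩
        e * ((fromℕ n - 1ℚ) * B)
          ≡⟨ solve 3 (λ m e x → m :* e :* x := e :* (m :* x)) refl (fromℕ n - 1ℚ) e B ⟨
        (fromℕ n - 1ℚ) * e * B                    ≡⟨ cong (_* B) e-inverse ⟩
        1ℚ * B                                    ≡⟨ *-identityˡ B ⟩
        B                                         ∎
        where X = Σπ n (λ π → v (π ⟨$⟩ʳ i) * v (π ⟨$⟩ʳ j))
      blocks : ∀ π → sumSq (round π v) ≡ ∑[ j < M ] sumSq (serve K (lookup S j) (λ k → v (π ⟨$⟩ʳ combine j k)))
      blocks π = trans (sum-combine M (λ i → round π v i * round π v i))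
        (sum-cong-≗ (λ j → sum-cong-≗ (λ k → cong (λ x → x * x) (mix-combine (λ i → v (π ⟨$⟩ʳ i)) j k))))
      total : Σπ n (λ π → sumSq (round π v)) ≡ fromℕ n * A - fromℕ ∣ S ∣ * ((fromℕ K - 1ℚ) * (A - B))
      total = begin
        Σπ n (λ π → sumSq (round π v))
          ≡⟨ trans (Σπ-cong n blocks) (∑ᴸ-∑ Π M (λ π j → sumSq (serve K (lookup S j) (λ k → v (π ⟨$⟩ʳ combine j k))))) ⟩
        ∑[ j < M ] Σπ n (λ π → sumSq (serve K (lookup S j) (λ k → v (π ⟨$⟩ʳ combine j k))))
          ≡⟨ sum-cong-≗ (λ j → Σπ-sumSq-serve K v single pair (combine j) (combine-injectiveʳ j _ j _) (lookup S j)) ⟩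
        ∑[ j < M ] (fromℕ K * A - indicator (lookup S j) * G)
          ≡⟨ ∑-distrib-- (λ _ → fromℕ K * A) (λ j → indicator (lookup S j) * G) ⟩
        ∑[ j < M ] (fromℕ K * A) - ∑[ j < M ] (indicator (lookup S j) * G)
          ≡⟨ cong₂ _-_
               (trans (sum-const M (fromℕ K * A))
                    (trans (sym (*-assoc (fromℕ M) (fromℕ K) A)) (cong (_* A) (sym (fromℕ-* M K)))))
               (trans (sym (*-distribʳ-sum G (λ j → indicator (lookup S j)))) (cong (_* G) (sum-indicator S))) ⟩
        fromℕ n * A - fromℕ ∣ S ∣ * G ∎
        where G = (fromℕ K - 1ℚ) * (A - B)

    -- Averaging over all rounds

    histories : ∀ t → List⁺ (Vec (Permutation′ n) t)
    histories = vectors (permutations n)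

    #histories : ℕ → ℚ
    #histories t = fromℕ (List⁺.length (histories t))

    -- `vectors` runs through the latest round outermost. Exchanging the sums puts it innermost, so
    -- that `Σπ-Φ` applies to each fixed past.
    sum-histories : ∀ t f → ∑⁺ (histories (suc t)) f ≡ ∑⁺ (histories t) (λ πs → Σπ n (λ π → f (π ∷ πs)))
    sum-histories t f = begin
      ∑⁺ (histories (suc t)) f
        ≡⟨ ∑⁺-concatMap (λ π → List⁺.map (π ∷_) (histories t)) (permutations n) f ⟩
      Σπ n (λ π → ∑⁺ (List⁺.map (π ∷_) (histories t)) f)
        ≡⟨ Σπ-cong n (λ π → ∑ᴸ-map (π ∷_) (List⁺.toList (histories t)) f) ⟩
      Σπ n (λ π → ∑⁺ (histories t) (λ πs → f (π ∷ πs)))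
        ≡⟨ ∑ᴸ-comm (List⁺.toList (permutations n)) (List⁺.toList (histories t)) (λ π πs → f (π ∷ πs)) ⟩
      ∑⁺ (histories t) (λ πs → Σπ n (λ π → f (π ∷ πs))) ∎

    #histories-suc : ∀ t → #histories (suc t) ≡ #histories t * #π n
    #histories-suc t = begin
      #histories (suc t)                                 ≡⟨ *-identityʳ _ ⟨
      #histories (suc t) * 1ℚ
        ≡⟨ ∑ᴸ-const (List⁺.toList (histories (suc t))) 1ℚ ⟨
      ∑⁺ (histories (suc t)) (λ _ → 1ℚ)                  ≡⟨ sum-histories t (λ _ → 1ℚ) ⟩
      ∑⁺ (histories t) (λ _ → Σπ n (λ _ → 1ℚ))           ≡⟨ ∑ᴸ-const (List⁺.toList (histories t)) _ ⟩
      #histories t * Σπ n (λ _ → 1ℚ)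
        ≡⟨ cong (#histories t *_) (trans (Σπ-const n 1ℚ) (*-identityʳ _)) ⟩
      #histories t * #π n                                ∎

    sum-Φ : ∀ t → ∑⁺ (histories t) Φ ≡ #histories t * (ρ ^ t * (1ℚ - (ℤ.+ 1 / n)))
    sum-Φ zero    = begin
      Φ [] + 0ℚ                   ≡⟨ +-identityʳ (Φ []) ⟩
      Φ []                        ≡⟨ cong (_- (ℤ.+ 1 / n)) (sumSq-unit n) ⟩
      1ℚ - (ℤ.+ 1 / n)
        ≡⟨ solve 1 (λ x → x := con 1ℚ :* (con 1ℚ :* x)) refl (1ℚ - (ℤ.+ 1 / n)) ⟩
      1ℚ * (1ℚ * (1ℚ - (ℤ.+ 1 / n))) ∎
    sum-Φ (suc t) = begin
      ∑⁺ (histories (suc t)) Φ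
        ≡⟨ sum-histories t Φ ⟩
      ∑⁺ (histories t) (λ πs → Σπ n (λ π → Φ (π ∷ πs)))
        ≡⟨ ∑ᴸ-cong H Σπ-Φ ⟩
      ∑⁺ (histories t) (λ πs → #π n * (ρ * Φ πs))
        ≡⟨ trans (∑ᴸ-*ˡ H (#π n) (λ πs → ρ * Φ πs)) (cong (#π n *_) (∑ᴸ-*ˡ H ρ Φ)) ⟩
      #π n * (ρ * ∑⁺ (histories t) Φ)
        ≡⟨ cong (λ x → #π n * (ρ * x)) (sum-Φ t) ⟩
      #π n * (ρ * (#histories t * (ρ ^ t * D)))
        ≡⟨ solve 5 (λ N r L p d → N :* (r :* (L :* (p :* d))) := L :* N :* (r :* p :* d))
                 refl (#π n) ρ (#histories t) (ρ ^ t) D ⟩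
      #histories t * #π n * (ρ * ρ ^ t * D)
        ≡⟨ cong (_* (ρ ^ suc t * D)) (#histories-suc t) ⟨
      #histories (suc t) * (ρ ^ suc t * D) ∎
      where
      H = List⁺.toList (histories t)
      D = 1ℚ - (ℤ.+ 1 / n)

    𝔼Φ-formula : ∀ t → 𝔼Φ t ≡ ρ ^ t * (1ℚ - (ℤ.+ 1 / n))
    𝔼Φ-formula t = begin
      𝔼Φ t                          ≡⟨ mean-map Φ (histories t) ⟩
      ∑⁺ (histories t) Φ * (ℤ.+ 1 / L)  ≡⟨ cong (_* (ℤ.+ 1 / L)) (sum-Φ t) ⟩
      fromℕ L * x * (ℤ.+ 1 / L)
        ≡⟨ solve 3 (λ l x h → l :* x :* h := h :* l :* x) refl (fromℕ L) x (ℤ.+ 1 / L) ⟩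
      (ℤ.+ 1 / L) * fromℕ L * x     ≡⟨ cong (_* x) (/-*-cancel (ℤ.+ 1) L) ⟩
      1ℚ * x                        ≡⟨ *-identityˡ x ⟩
      x                             ∎
      where
      L = List⁺.length (histories t)
      x = ρ ^ t * (1ℚ - (ℤ.+ 1 / n))

-- Powers and logarithms

module _ where
  open import Data.Rational.Base using (_*_; _≤_)

  *-monoʳ-< : ∀ {p q r} → 0ℚ < r → p < q → p * r < q * r
  *-monoʳ-< {r = r} 0<r = *-monoˡ-<-pos r {{positive 0<r}}

  *-cancelʳ-< : ∀ {p q r} → 0ℚ < r → p * r < q * r → p < q
  *-cancelʳ-< {r = r} 0<r = *-cancelʳ-<-nonNeg r {{nonNegative (<⇒≤ 0<r)}}

  *-mono-≤ : ∀ {p q r s} → 0ℚ ≤ r → 0ℚ ≤ q → p ≤ q → r ≤ s → p * r ≤ q * s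
  *-mono-≤ {p} {q} {r} {s} 0≤r 0≤q p≤q r≤s = ≤-trans
    (*-monoʳ-≤-nonNeg r {{nonNegative 0≤r}} p≤q) (*-monoˡ-≤-nonNeg q {{nonNegative 0≤q}} r≤s)

  0≤* : ∀ {p q} → 0ℚ ≤ p → 0ℚ ≤ q → 0ℚ ≤ p * q
  0≤* {p} {q} 0≤p 0≤q = *-mono-≤ {0ℚ} {p} {0ℚ} ≤-refl 0≤p 0≤p 0≤q

  0<* : ∀ {p q} → 0ℚ < p → 0ℚ < q → 0ℚ < p * q
  0<* {p} {q} 0<p 0<q = subst (_< p * q) (*-zeroˡ q) (*-monoʳ-< 0<q 0<p)

  inverse : ∀ {y} → 0ℚ < y → ∃[ z ] z * y ≡ 1ℚ
  inverse {y} 0<y = (1/ y) {{≢0}} , *-inverseˡ y {{≢0}}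
    where ≢0 = pos⇒nonZero y {{positive 0<y}}

  quotient-of : ∀ {y} z → 0ℚ < y → ∃[ u ] u * y ≡ z
  quotient-of {y} z 0<y with y⁻¹ , eq ← inverse 0<y =
    z * y⁻¹ , trans (*-assoc z y⁻¹ y) (trans (cong (z *_) eq) (*-identityʳ z))

  -- A rational strictly between x and p * y, divided by y, leaves room on both sides.
  shrink : ∀ {x p y} → 0ℚ ≤ x → 0ℚ < y → x < p * y → ∃[ u ] (0ℚ < u × u < p × x < u * y)
  shrink {x} {p} {y} 0≤x 0<y x<py
    with z , x<z , z<py ← <-dense x<py
    with u , refl ← quotient-of z 0<y =
    u , *-cancelʳ-< 0<y (subst (_< u * y) (sym (*-zeroˡ y)) (≤-<-trans 0≤x x<z)) , *-cancelʳ-< 0<y z<py , x<z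

  grow : ∀ {x p y} → 0ℚ < y → y * p < x → ∃[ u ] (p < u × y * u < x)
  grow {x} {p} {y} 0<y yp<x
    with z , yp<z , z<x ← <-dense yp<x
    with u , refl ← quotient-of z 0<y =
    u , *-cancelʳ-< 0<y (subst (_< u * y) (*-comm y p) yp<z) , subst (_< x) (*-comm u y) z<x

  module _ {p : ℚ} where

    0≤^ : 0ℚ ≤ p → ∀ k → 0ℚ ≤ p ^ k
    0≤^ 0≤p zero    = from-yes (0ℚ ≤? 1ℚ)
    0≤^ 0≤p (suc k) = 0≤* 0≤p (0≤^ 0≤p k)

    0<^ : 0ℚ < p → ∀ k → 0ℚ < p ^ k
    0<^ 0<p zero    = from-yes (0ℚ <? 1ℚ)
    0<^ 0<p (suc k) = 0<* 0<p (0<^ 0<p k)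

    ^-monoˡ-≤ : ∀ {q} → 0ℚ ≤ p → p ≤ q → ∀ k → p ^ k ≤ q ^ k
    ^-monoˡ-≤ 0≤p p≤q zero    = ≤-refl
    ^-monoˡ-≤ 0≤p p≤q (suc k) = *-mono-≤ (0≤^ 0≤p k) (≤-trans 0≤p p≤q) p≤q (^-monoˡ-≤ 0≤p p≤q k)

  1^k≡1 : ∀ k → 1ℚ ^ k ≡ 1ℚ
  1^k≡1 zero    = refl
  1^k≡1 (suc k) = trans (*-identityˡ (1ℚ ^ k)) (1^k≡1 k)

  ^-≤1 : ∀ {p} → 0ℚ ≤ p → p ≤ 1ℚ → ∀ k → p ^ k ≤ 1ℚ
  ^-≤1 {p} 0≤p p≤1 k = subst (p ^ k ≤_) (1^k≡1 k) (^-monoˡ-≤ 0≤p p≤1 k)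

  1≤^ : ∀ {p} → 1ℚ ≤ p → ∀ k → 1ℚ ≤ p ^ k
  1≤^ {p} 1≤p k = subst (_≤ p ^ k) (1^k≡1 k) (^-monoˡ-≤ (from-yes (0ℚ ≤? 1ℚ)) 1≤p k)

  1<^ : ∀ {p} → 1ℚ < p → ∀ k .{{_ : NonZero k}} → 1ℚ < p ^ k
  1<^ {p} 1<p (suc k) = <-≤-trans 1<p
    (subst (_≤ p * p ^ k) (*-identityʳ p)
      (*-mono-≤ (from-yes (0ℚ ≤? 1ℚ)) 0≤p (≤-refl {p}) (1≤^ (<⇒≤ 1<p) k)))
    where 0≤p = ≤-trans (from-yes (0ℚ ≤? 1ℚ)) (<⇒≤ 1<p)

  1<^⇒1< : ∀ {p} → 0ℚ ≤ p → ∀ k → 1ℚ < p ^ k → 1ℚ < p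
  1<^⇒1< 0≤p k 1<p^k = ≰⇒> λ p≤1 → <⇒≱ 1<p^k (^-≤1 0≤p p≤1 k)
    where
    <⇒≱ : ∀ {x y} → x < y → ¬ y ≤ x
    <⇒≱ x<y y≤x = <-irrefl refl (<-≤-trans x<y y≤x)

  fromℕ-^ : ∀ m k → fromℕ (m ℕ.^ k) ≡ fromℕ m ^ k
  fromℕ-^ m zero    = refl
  fromℕ-^ m (suc k) = trans (fromℕ-* m (m ℕ.^ k)) (cong (fromℕ m *_) (fromℕ-^ m k))

  -- Left continuity of powers. First `p ^ k` is lowered to y, then p to u; induction gives v with y
  -- < v ^ k, and the larger of u and v serves for both.
  ^-shrink : ∀ {x p} k → 0ℚ ≤ x → 0ℚ < p → x < p ^ k → ∃[ u ] (0ℚ < u × u < p × x < u ^ k)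
  ^-shrink zero    0≤x 0<p x<1 with u , 0<u , u<p ← <-dense 0<p = u , 0<u , u<p , x<1
  ^-shrink {x} {p} (suc k) 0≤x 0<p x<p^k
    with y , 0<y , y<p^k , x<yp ← shrink 0≤x 0<p (subst (x <_) (*-comm p (p ^ k)) x<p^k)
    with u , 0<u , u<p , x<uy ← shrink 0≤x 0<y (subst (x <_) (*-comm y p) x<yp)
    with v , 0<v , v<p , y<v^k ← ^-shrink k (<⇒≤ 0<y) 0<p y<p^k
    with ≤-total u v
  ... | inj₁ u≤v = v , 0<v , v<p , <-≤-trans x<uy (*-mono-≤ (<⇒≤ 0<y) (<⇒≤ 0<v) u≤v (<⇒≤ y<v^k))
  ... | inj₂ v≤u = u , 0<u , u<p , <-≤-trans x<uy (*-mono-≤ (<⇒≤ 0<y) (<⇒≤ 0<u) (≤-refl {u})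
                     (≤-trans (<⇒≤ y<v^k) (^-monoˡ-≤ (<⇒≤ 0<v) v≤u k)))

  1<^*-shrink : ∀ {p C} k → 0ℚ < C → 0ℚ < p → 1ℚ < p ^ k * C →
                ∃[ u ] (0ℚ < u × u < p × 1ℚ < u ^ k * C)
  1<^*-shrink {p} {C} k 0<C 0<p lt
    with y , 0<y , y<p^k , 1<yC ← shrink {1ℚ} {p ^ k} {C} (from-yes (0ℚ ≤? 1ℚ)) 0<C lt
    with u , 0<u , u<p , y<u^k ← ^-shrink k (<⇒≤ 0<y) 0<p y<p^k =
    u , 0<u , u<p , <-trans 1<yC (*-monoʳ-< 0<C y<u^k)

  -- Exponents in lowest terms

  nonNeg⇒↥≡+ : ∀ p → 0ℚ ≤ p → ∃[ k ] ↥ p ≡ ℤ.+ k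
  nonNeg⇒↥≡+ (mkℚ (ℤ.+ k)  _ _) 0≤p = k , refl
  nonNeg⇒↥≡+ (mkℚ -[1+ k ] _ _) (*≤* ())

  0≤/ : ∀ k d .{{_ : NonZero d}} → 0ℚ ≤ ℤ.+ k / d
  0≤/ k d = nonNegative⁻¹ (ℤ.+ k / d) {{normalize-nonNeg k d}}

  -- `_^ℚ_` reads its exponent in lowest terms, whereas exponents such as t d / k arise unreduced.
  -- Here g is the common factor, and g-th roots of inequalities lead from k and d to the reduced
  -- pair.
  Reduces : ℚ → ℕ → ℕ → Set
  Reduces q k d = ∃[ a ] ∃[ g ] (↥ q ≡ ℤ.+ a × a ℕ.* g ≡ k × ↧ₙ q ℕ.* g ≡ d)

  lowest-terms : ∀ k d .{{_ : NonZero d}} → Reduces (ℤ.+ k / d) k d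
  lowest-terms k d with a , eq ← nonNeg⇒↥≡+ (ℤ.+ k / d) (0≤/ k d) =
    a , g , eq , ℤ.+-injective num , ℤ.+-injective den
    where
    g = ℤ.∣ gcd (ℤ.+ k) (ℤ.+ d) ∣
    num : ℤ.+ (a ℕ.* g) ≡ ℤ.+ k
    num = trans (ℤ.pos-* a g) (trans (cong (ℤ._* ℤ.+ g) (sym eq)) (↥-/ (ℤ.+ k) d))
    den : ℤ.+ (↧ₙ (ℤ.+ k / d) ℕ.* g) ≡ ℤ.+ d
    den = trans (ℤ.pos-* (↧ₙ (ℤ.+ k / d)) g) (↧-/ (ℤ.+ k) d)

  ℕ^-cancel-< : ∀ {a b} g → a ℕ.^ g ℕ.< b ℕ.^ g → a ℕ.< b
  ℕ^-cancel-< g lt = ℕ.≰⇒> λ b≤a → ℕ.<⇒≱ lt (ℕ.^-monoˡ-≤ g b≤a)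

  lowest-^-< : ∀ m l {a b} a′ b′ {g} → a′ ℕ.* g ≡ a → b′ ℕ.* g ≡ b →
               m ℕ.^ a ℕ.< l ℕ.^ b → m ℕ.^ a′ ℕ.< l ℕ.^ b′
  lowest-^-< m l a′ b′ {g} refl refl lt = ℕ^-cancel-< g
    (subst₂ ℕ._<_ (sym (ℕ.^-*-assoc m a′ g)) (sym (ℕ.^-*-assoc l b′ g)) lt)

  log₂-lower : ∀ m q {a b} → Reduces q a b → 0 ℕ.< m → 2 ℕ.^ a ℕ.< m ℕ.^ b → lower (log₂ m) q
  log₂-lower m q (a′ , g , num , eqᵃ , eqᵇ) 0<m lt =
    fromℕ-mono-< {0} {m} 0<m ,
    subst₂ _<_ (cong (2 ^ℤ_) (sym num)) (fromℕ-^ m b′)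
      (fromℕ-mono-< {2 ℕ.^ a′} {m ℕ.^ b′} (lowest-^-< 2 m a′ b′ eqᵃ eqᵇ lt))
    where b′ = ↧ₙ q

  log₂-upper : ∀ m q {a b} → Reduces q a b → m ℕ.^ b ℕ.< 2 ℕ.^ a → upper (log₂ m) q
  log₂-upper m q (a′ , g , num , eqᵃ , eqᵇ) lt =
    inj₂ (subst₂ _<_ (fromℕ-^ m b′) (cong (2 ^ℤ_) (sym num))
      (fromℕ-mono-< {m ℕ.^ b′} {2 ℕ.^ a′} (lowest-^-< m 2 b′ a′ eqᵇ eqᵃ lt)))
    where b′ = ↧ₙ q

  module _ (m : ℕ) .{{_ : NonZero m}} where

    ^ℤ-neg : ∀ k → m ^ℤ (ℤ.- (ℤ.+ k)) * fromℕ (m ℕ.^ k) ≡ 1ℚ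
    ^ℤ-neg zero    = refl
    ^ℤ-neg (suc k) = /-*-cancel (ℤ.+ 1) (m ℕ.^ suc k) {{ℕ.m^n≢0 m (suc k)}}

    0<m^k : ∀ k → 0ℚ < fromℕ (m ℕ.^ k)
    0<m^k k = fromℕ-pos (m ℕ.^ k) {{ℕ.m^n≢0 m k}}

    ^ℤ-negsuc-≤1 : ∀ k → m ^ℤ -[1+ k ] ≤ 1ℚ
    ^ℤ-negsuc-≤1 k = ≮⇒≥ λ 1<x → <-irrefl refl (subst (1ℚ <_) (^ℤ-neg (suc k))
      (<-≤-trans 1<x (subst (_≤ x * N) (*-identityʳ x)
        (*-mono-≤ (from-yes (0ℚ ≤? 1ℚ)) (<⇒≤ (<-trans (from-yes (0ℚ <? 1ℚ)) 1<x)) (≤-refl {x})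
          (fromℕ-mono-≤ {1} {m ℕ.^ suc k} (ℕ.>-nonZero⁻¹ (m ℕ.^ suc k) {{ℕ.m^n≢0 m (suc k)}}))))))
      where
      x = m ^ℤ -[1+ k ]
      N = fromℕ (m ℕ.^ suc k)

    -- Multiplied out, u > m ^ (- k / d) is 1 < u ^ d m ^ k, whose right side is the g-th power of
    -- the same expression in lowest terms.
    ^ℚ-neg-upper : ∀ q {k d u} → Reduces q k d → 0ℚ < u → 1ℚ < u ^ d * fromℕ (m ℕ.^ k) →
                   upper (m ^ℚ (- q)) u
    ^ℚ-neg-upper q {k} {d} {u} (a , g , num , eqᵃ , eqᵇ) 0<u lt =
      0<u , subst₂ (λ z l → m ^ℤ z < u ^ l)
              (sym (trans (↥-neg q) (cong ℤ.-_ num)))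
              (sym (ℤ.+-injective (↧-neg q)))
              (*-cancelʳ-< (0<m^k a) (subst (_< u ^ b * fromℕ (m ℕ.^ a)) (sym (^ℤ-neg a)) root))
      where
      b = ↧ₙ q
      power : (u ^ b * fromℕ (m ℕ.^ a)) ^ g ≡ u ^ d * fromℕ (m ℕ.^ k)
      power = begin
        (u ^ b * fromℕ (m ℕ.^ a)) ^ g         ≡⟨ ^-distrib-* (u ^ b) (fromℕ (m ℕ.^ a)) g ⟩
        (u ^ b) ^ g * fromℕ (m ℕ.^ a) ^ g
          ≡⟨ cong₂ _*_ (^-assocʳ u b g) (sym (fromℕ-^ (m ℕ.^ a) g)) ⟩
        u ^ (b ℕ.* g) * fromℕ ((m ℕ.^ a) ℕ.^ g)
          ≡⟨ cong₂ (λ x y → u ^ x * fromℕ y) eqᵇ (trans (ℕ.^-*-assoc m a g) (cong (m ℕ.^_) eqᵃ)) ⟩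
        u ^ d * fromℕ (m ℕ.^ k)               ∎
        where open ≡-Reasoning
      root : 1ℚ < u ^ b * fromℕ (m ℕ.^ a)
      root = 1<^⇒1< (<⇒≤ (0<* (0<^ 0<u b) (0<m^k a))) g (subst (1ℚ <_) (sym power) lt)

    -- Clearing the denominator of β turns ρ ^ t > m ^ (- β) into an inequality
    -- between integral powers.
    clear-denominator : ∀ {ρ t β p} → 0ℚ ≤ ρ → ρ ≤ 1ℚ →
      lower (m ^ℚ β) p → 0ℚ < p → 1ℚ < ρ ^ t * p →
      ∃[ k ] (↥ β ≡ ℤ.+ k × 1ℚ < ρ ^ (t ℕ.* ↧ₙ β) * fromℕ (m ℕ.^ k))
    clear-denominator 0≤ρ ρ≤1 (inj₁ p<0) 0<p 1<ρp = contradiction 0<p (<-asym p<0)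
    clear-denominator {ρ} {t} {β@record{}} {p} 0≤ρ ρ≤1 (inj₂ p^d<) 0<p 1<ρp = go (↥ β) refl
      where
      d = ↧ₙ β
      bound : 1ℚ < ρ ^ (t ℕ.* d) * (m ^ℤ (↥ β))
      bound = <-≤-trans
        (subst (1ℚ <_) (trans (^-distrib-* (ρ ^ t) p d) (cong (_* p ^ d) (^-assocʳ ρ t d))) (1<^ 1<ρp d))
        (*-mono-≤ (0≤^ (<⇒≤ 0<p) d) (0≤^ 0≤ρ (t ℕ.* d)) ≤-refl (<⇒≤ p^d<))
      go : ∀ z → ↥ β ≡ z → ∃[ k ] (↥ β ≡ ℤ.+ k × 1ℚ < ρ ^ (t ℕ.* d) * fromℕ (m ℕ.^ k))
      go (ℤ.+ k) eq = k , eq , subst (λ z → 1ℚ < ρ ^ (t ℕ.* d) * (m ^ℤ z)) eq bound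
      go -[1+ k ] eq = contradiction
        (<-≤-trans (subst (λ z → 1ℚ < ρ ^ (t ℕ.* d) * (m ^ℤ z)) eq bound)
          (≤-trans (*-mono-≤ (<⇒≤ 0<x) (from-yes (0ℚ ≤? 1ℚ)) (^-≤1 0≤ρ ρ≤1 (t ℕ.* d)) (^ℤ-negsuc-≤1 k))
                   (≤-reflexive (*-identityˡ 1ℚ))))
        (<-irrefl refl)
        where
        0<x : 0ℚ < m ^ℤ -[1+ k ]
        0<x = *-cancelʳ-< (0<m^k (suc k))
          (subst₂ _<_ (sym (*-zeroˡ (fromℕ (m ℕ.^ suc k)))) (sym (^ℤ-neg (suc k))) (from-yes (0ℚ <? 1ℚ)))

-- Dedekind cuts

module _ where
  open import Data.Rational.Base using (_*_; _≤_)

  lower≤upper : ∀ {x p q} → IsReal x → lower x p → upper x q → p ≤ q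
  lower≤upper {x} {p} {q} x-real lp uq = ≮⇒≥ λ q<p →
    IsReal.disjoint x-real (lp , IsReal.upper-closed x-real q<p uq)

  -- Locatedness makes the negative hypothesis positive: for q < r < p, either q is below x, or r is
  -- above x and x would be strictly less than p.
  lower-below : ∀ {x p q} → IsReal x → fromℚ p ≤ᴿ x → q < p → lower x q
  lower-below x-real p≤x q<p with r , q<r , r<p ← <-dense q<p with IsReal.located x-real q<r
  ... | inj₁ lq = lq
  ... | inj₂ ur = contradiction (r , ur , r<p) p≤x

  -- With nonnegative lower endpoints, a c is the least of the four corner products.
  *ᴿ-lower : ∀ {x y a b c d q} → lower x a → upper x b → lower y c → upper y d →
             0ℚ ≤ a → a ≤ b → 0ℚ ≤ c → c ≤ d → q < a * c → lower (x *ᴿ y) q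
  *ᴿ-lower {a = a} {b} {c} {d} la ub lc ud 0≤a a≤b 0≤c c≤d q<ac =
    a , b , c , d , (la , ub , lc , ud) ,
    (q<ac , <-≤-trans q<ac (*-mono-≤ 0≤c 0≤a ≤-refl c≤d) ,
     <-≤-trans q<ac (*-mono-≤ 0≤c 0≤b a≤b ≤-refl) ,
     <-≤-trans q<ac (*-mono-≤ 0≤c 0≤b a≤b c≤d))
    where 0≤b = ≤-trans 0≤a a≤b

  -- The upper endpoint d of y is an argument because y may be `log₂ n` or `fromℚ κ`, for which no
  -- `IsReal` is at hand.
  <ᴿ-* : ∀ {x y a c d p} → IsReal x → lower x a → lower y c → upper y d →
         0ℚ ≤ a → 0ℚ ≤ c → c ≤ d → p < a * c → fromℚ p <ᴿ x *ᴿ y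
  <ᴿ-* x-real la lc ud 0≤a 0≤c c≤d p<ac
    with q , p<q , q<ac ← <-dense p<ac
    with b , ub ← IsReal.upper-inhabited x-real =
    q , p<q , *ᴿ-lower la ub lc ud 0≤a (lower≤upper x-real la ub) 0≤c c≤d q<ac

  -- A violation unfolds to rationals β < b and p < n ^ β with 1 < q p, by way of some r < q.
  ≤ᴿ-recip-^ : ∀ {n b q} .{{_ : NonZero n}} →
    (∀ {β p} → lower b β → lower (n ^ℚ β) p → 0ℚ < p → ¬ 1ℚ < q * p) →
    fromℚ q ≤ᴿ recip (n ^ᴿ b)
  ≤ᴿ-recip-^ bound (r , (p , (β , lβ , lp) , 0<p , 1<rp) , r<q) =
    bound lβ lp 0<p (<-trans 1<rp (*-monoʳ-< 0<p r<q))

  ↥*-cancel : ∀ β {k} → ↥ β ≡ ℤ.+ k → β * fromℕ (↧ₙ β) ≡ fromℕ k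
  ↥*-cancel β {k} eq = begin
    β * fromℕ (↧ₙ β)                   ≡⟨ cong (_* fromℕ (↧ₙ β)) (↥p/↧p≡p β) ⟨
    (↥ β / ↧ₙ β) * fromℕ (↧ₙ β)        ≡⟨ /-*-cancel (↥ β) (↧ₙ β) ⟩
    ↥ β / 1                            ≡⟨ cong (_/ 1) eq ⟩
    fromℕ k                            ∎
    where open ≡-Reasoning

  0</ : ∀ k d .{{_ : NonZero k}} .{{_ : NonZero d}} → 0ℚ < ℤ.+ k / d
  0</ k d = *-cancelʳ-< (fromℕ-pos d)
    (subst₂ _<_ (sym (*-zeroˡ (fromℕ d))) (sym (/-*-cancel (ℤ.+ k) d)) (fromℕ-pos k))

  /-*-/ : ∀ k d .{{_ : NonZero k}} .{{_ : NonZero d}} → (ℤ.+ k / d) * (ℤ.+ d / k) ≡ 1ℚ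
  /-*-/ k d = fromℕ-cancelˡ k $ begin
    fromℕ k * ((ℤ.+ k / d) * (ℤ.+ d / k))
      ≡⟨ solve 3 (λ k x y → k :* (x :* y) := x :* (y :* k)) refl (fromℕ k) (ℤ.+ k / d) (ℤ.+ d / k) ⟩
    (ℤ.+ k / d) * ((ℤ.+ d / k) * fromℕ k)  ≡⟨ cong ((ℤ.+ k / d) *_) (/-*-cancel (ℤ.+ d) k) ⟩
    (ℤ.+ k / d) * fromℕ d                  ≡⟨ /-*-cancel (ℤ.+ k) d ⟩
    fromℕ k                                ≡⟨ *-identityʳ (fromℕ k) ⟨
    fromℕ k * 1ℚ                           ∎
    where open ≡-Reasoning

  n<2^n : ∀ m → m ℕ.< 2 ℕ.^ m
  n<2^n zero    = ℕ.s≤s ℕ.z≤n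
  n<2^n (suc m) = begin-strict
    1 ℕ.+ m                ≤⟨ n<2^n m ⟩
    2 ℕ.^ m                <⟨ ℕ.^-monoʳ-< 2 (ℕ.s≤s (ℕ.s≤s ℕ.z≤n)) (ℕ.n<1+n m) ⟩
    2 ℕ.^ suc m            ∎
    where open ℕ.≤-Reasoning

  log₂-upper-ℕ : ∀ n {m} → n ℕ.≤ m → upper (log₂ n) (fromℕ m)
  log₂-upper-ℕ n {m} n≤m = log₂-upper n (fromℕ m) (lowest-terms m 1)
    (subst (ℕ._< 2 ℕ.^ m) (sym (ℕ.^-identityʳ n)) (ℕ.≤-<-trans n≤m (n<2^n m)))

  ½^N*2^N≡1 : ∀ N → ½ ^ N * fromℕ (2 ℕ.^ N) ≡ 1ℚ
  ½^N*2^N≡1 N = trans (cong (½ ^ N *_) (fromℕ-^ 2 N)) (trans (sym (^-distrib-* ½ (fromℕ 2) N)) (1^k≡1 N))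

  1<p^k*x⇒0<p : ∀ {p x} k .{{_ : NonZero k}} → 0ℚ ≤ p → 1ℚ < p ^ k * x → 0ℚ < p
  1<p^k*x⇒0<p {x = x} (suc k) 0≤p large = ≰⇒> λ p≤0 → <-asym (from-yes (0ℚ <? 1ℚ)) (subst (1ℚ <_)
    (trans (cong (λ z → z * z ^ k * x) (≤-antisym p≤0 0≤p))
           (trans (cong (_* x) (*-zeroˡ (0ℚ ^ k))) (*-zeroˡ x)))
    large)

  -- If ρ > 1/2, then s = (1 - ρ) κ < κ / 2. Lowering 1/2 to some a, hence below ε, and then κ to
  -- some z keeps s < z a, so s < ε κ.
  ≤ᴿ⇒ρ≤½ : ∀ {ε s κ ρ} → 0ℚ < κ → IsReal ε → fromℚ ½ ≤ᴿ ε → 0ℚ ≤ s → s ≡ (1ℚ - ρ) * κ →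
           ε *ᴿ fromℚ κ ≤ᴿ fromℚ s → ρ ≤ ½
  ≤ᴿ⇒ρ≤½ {ε} {s} {κ} {ρ} 0<κ ε-real ½≤ε 0≤s s≡ εκ≤s = ≮⇒≥ impossible
    where
    -- κ + 1 is an arbitrary upper endpoint for `fromℚ κ` in the interval product.
    κ<κ+1 : κ < κ + 1ℚ
    κ<κ+1 = subst (_< κ + 1ℚ) (+-identityʳ κ) (+-monoʳ-< κ {0ℚ} {1ℚ} (from-yes (0ℚ <? 1ℚ)))
    exceeds : ∀ {a} → 0ℚ < a → a < ½ → ∃[ z ] (0ℚ < z × z < κ × s < z * a) → ⊥
    exceeds {a} 0<a a<½ (z , 0<z , z<κ , s<za) = εκ≤s
      (<ᴿ-* {ε} {fromℚ κ} {a} {z} {κ + 1ℚ} {s} ε-real (lower-below ε-real ½≤ε a<½) z<κ κ<κ+1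
        (<⇒≤ 0<a) (<⇒≤ 0<z) (<⇒≤ (<-trans z<κ κ<κ+1)) (subst (s <_) (*-comm z a) s<za))
    below-½ : ∃[ a ] (0ℚ < a × a < ½ × s < a * κ) → ⊥
    below-½ (a , 0<a , a<½ , s<aκ) =
      exceeds 0<a a<½ (shrink {s} {κ} {a} 0≤s 0<a (subst (s <_) (*-comm a κ) s<aκ))
    1-ρ<½ : ½ < ρ → 1ℚ - ρ < ½
    1-ρ<½ ½<ρ = +-monoʳ-< 1ℚ { - ρ} { - ½} (neg-antimono-< ½<ρ)
    impossible : ¬ ½ < ρ
    impossible ½<ρ = below-½ (shrink {s} {½} {κ} 0≤s 0<κ
      (subst (_< ½ * κ) (sym s≡) (*-monoʳ-< {1ℚ - ρ} {½} {κ} 0<κ (1-ρ<½ ½<ρ))))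

  -- Refuting violations of the bound

  module _ (n : ℕ) .{{_ : NonZero n}} (b : Cut) (b-real : IsReal b) (1≤b : fromℚ 1ℚ ≤ᴿ b)
           {ρ : ℚ} (0≤ρ : 0ℚ ≤ ρ) (ρ≤1 : ρ ≤ 1ℚ) where

    -- With β = k / d this is ρ ^ t > n ^ (- β) raised to the d-th power.
    Large : ℕ → Set
    Large t = ∃[ β ] ∃[ k ] (lower b β × ↥ β ≡ ℤ.+ k × 1ℚ < ρ ^ (t ℕ.* ↧ₙ β) * fromℕ (n ℕ.^ k))

    ≤ᴿ-recip : ∀ {t q} → q ≤ ρ ^ t → ¬ Large t → fromℚ q ≤ᴿ recip (n ^ᴿ b)
    ≤ᴿ-recip {t} {q} q≤ρ^t small = ≤ᴿ-recip-^ {n} {b} {q} λ {β} {p} lβ lp 0<p 1<qp →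
      let k , num , 1<ρn = clear-denominator n {t = t} {β = β} 0≤ρ ρ≤1 lp 0<p
                     (<-≤-trans 1<qp (*-mono-≤ (<⇒≤ 0<p) (0≤^ 0≤ρ t) q≤ρ^t ≤-refl))
      in small (β , k , lβ , num , 1<ρn)

    private
      lower-½ : lower b ½
      lower-½ = lower-below b-real 1≤b (from-yes (½ <? 1ℚ))

      0<¼ : 0ℚ < ½ * ½
      0<¼ = from-yes (0ℚ <? ½ * ½)

      0≤½ : 0ℚ ≤ ½
      0≤½ = from-yes (0ℚ ≤? ½)

    ρ^N≤1 : ∀ N → ρ ^ N * fromℕ 1 ≤ 1ℚ
    ρ^N≤1 N = subst (_≤ 1ℚ) (sym (*-identityʳ (ρ ^ N))) (^-≤1 0≤ρ ρ≤1 N)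

    module _ {β γ τ : ℚ} (lβ : lower b β) (0<β : 0ℚ < β) (0<γ : 0ℚ < γ) (β*γ≡τ : β * γ ≡ τ) where

      -- β γ only equals τ, while refuting an upper bound τ takes a product strictly above it.
      increase : ∃[ β⁺ ] (0ℚ < β⁺ × lower b β⁺ × τ < β⁺ * γ)
      increase with β⁺ , β<β⁺ , lβ⁺ ← IsReal.lower-rounded b-real lβ =
        β⁺ , <-trans 0<β β<β⁺ , lβ⁺ , subst (_< β⁺ * γ) β*γ≡τ (*-monoʳ-< 0<γ β<β⁺)

      lower-γ⇒<ᴿ : ∀ {y D} → lower y γ → upper y D → γ ≤ D → fromℚ τ <ᴿ b *ᴿ y
      lower-γ⇒<ᴿ lγ uD γ≤D with β⁺ , 0<β⁺ , lβ⁺ , τ<β⁺γ ← increase =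
        <ᴿ-* b-real lβ⁺ lγ uD (<⇒≤ 0<β⁺) (<⇒≤ 0<γ) γ≤D τ<β⁺γ

      -- β⁺ γ > τ leaves room for some y < γ with y β⁺ > τ. If y were below c, then b c would exceed
      -- τ; so c, located between y and γ, is below γ.
      ≤ᴿ⇒upper-γ : ∀ {c} → IsReal c → b *ᴿ c ≤ᴿ fromℚ τ → upper c γ
      ≤ᴿ⇒upper-γ {c} c-real bc≤τ
        with β⁺ , 0<β⁺ , lβ⁺ , τ<β⁺γ ← increase
        with c⁺ , uc⁺ ← IsReal.upper-inhabited c-real
        with y , 0<y , y<γ , τ<yβ⁺ ← shrink {τ} {γ} {β⁺} (<⇒≤ (subst (0ℚ <_) β*γ≡τ (0<* 0<β 0<γ))) 0<β⁺
                                       (subst (τ <_) (*-comm β⁺ γ) τ<β⁺γ)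
        with IsReal.located c-real y<γ
      ... | inj₂ uγ = uγ
      ... | inj₁ ly = contradiction
        (<ᴿ-* b-real lβ⁺ ly uc⁺ (<⇒≤ 0<β⁺) (<⇒≤ 0<y) (lower≤upper c-real ly uc⁺)
          (subst (τ <_) (*-comm y β⁺) τ<yβ⁺))
        bc≤τ

    module Exponent (t : ℕ) {β : ℚ} {k : ℕ} (lβ : lower b β) (num : ↥ β ≡ ℤ.+ suc k) where

      d : ℕ
      d = ↧ₙ β

      -- t / β, written as a fraction of naturals to suit `lowest-terms`.
      γ : ℚ
      γ = ℤ.+ (t ℕ.* d) / suc k

      γ*k≡td : fromℕ (suc k) * γ ≡ fromℕ t * fromℕ d
      γ*k≡td = trans (*-comm (fromℕ (suc k)) γ) (trans (/-*-cancel (ℤ.+ (t ℕ.* d)) (suc k)) (fromℕ-* t d))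

      β*γ≡t : β * γ ≡ fromℕ t
      β*γ≡t = fromℕ-cancelˡ (suc k) $ begin
        fromℕ (suc k) * (β * γ)
          ≡⟨ solve 3 (λ k b g → k :* (b :* g) := b :* (k :* g)) refl (fromℕ (suc k)) β γ ⟩
        β * (fromℕ (suc k) * γ)      ≡⟨ cong (β *_) γ*k≡td ⟩
        β * (fromℕ t * fromℕ d)
          ≡⟨ solve 3 (λ b t d → b :* (t :* d) := b :* d :* t) refl β (fromℕ t) (fromℕ d) ⟩
        β * fromℕ d * fromℕ t        ≡⟨ cong (_* fromℕ t) (↥*-cancel β num) ⟩
        fromℕ (suc k) * fromℕ t      ∎
        where open ≡-Reasoning

      0<β : 0ℚ < β
      0<β = *-cancelʳ-< (fromℕ-pos d)
        (subst₂ _<_ (sym (*-zeroˡ (fromℕ d))) (sym (↥*-cancel β num)) (fromℕ-pos (suc k)))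

      0<γ : .{{NonZero t}} → 0ℚ < γ
      0<γ = *-cancelʳ-< 0<β
        (subst₂ _<_ (sym (*-zeroˡ β)) (trans (sym β*γ≡t) (*-comm β γ)) (fromℕ-pos t))

    ≤ᴿ⇒¬Large-log₂ : 1 ℕ.< n → ρ ≤ ½ → ∀ t → b *ᴿ log₂ n ≤ᴿ fromℚ (fromℕ t) → ¬ Large t
    -- β = 0 makes n ^ β equal to 1, and powers of ρ are at most 1.
    ≤ᴿ⇒¬Large-log₂ 1<n ρ≤½ t b*log≤t (β , zero , lβ , num , large) =
      <-irrefl refl (<-≤-trans large (ρ^N≤1 (t ℕ.* ↧ₙ β)))
    -- For t = 0 the quotient γ is not positive, so b log₂ n ≤ 0 is refuted directly: 1/2 < b, and
    -- 1/2 < log₂ n since 2 < n².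
    ≤ᴿ⇒¬Large-log₂ 1<n ρ≤½ zero b*log≤t (β , suc k , lβ , num , large) = b*log≤t
      (<ᴿ-* {y = log₂ n} b-real lower-½ (log₂-lower n ½ (lowest-terms 1 2) (ℕ.<⇒≤ 1<n) 2<n²)
        (log₂-upper-ℕ n {n} ℕ.≤-refl) 0≤½ 0≤½
        (≤-trans (from-yes (½ ≤? fromℕ 1)) (fromℕ-mono-≤ (ℕ.<⇒≤ 1<n))) 0<¼)
      where
      2<n² : 2 ℕ.^ 1 ℕ.< n ℕ.^ 2
      2<n² = ℕ.≤-trans (from-yes (3 ℕ.≤? 4)) (ℕ.^-monoˡ-≤ 2 1<n)
    ≤ᴿ⇒¬Large-log₂ 1<n ρ≤½ t@(suc _) b*log≤t (β , suc k , lβ , num , large) = b*log≤t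
      (lower-γ⇒<ᴿ lβ 0<β 0<γ β*γ≡t {y = log₂ n}
        (log₂-lower n γ (lowest-terms N (suc k)) (ℕ.<⇒≤ 1<n) 2^N<n^k)
        -- The endpoint N + n is above log₂ n through the summand n and at least γ through the
        -- summand N.
        (log₂-upper-ℕ n {N ℕ.+ n} (ℕ.m≤n+m n N)) γ≤D)
      where
      open Exponent t lβ num
      N = t ℕ.* d
      2^N<n^k : 2 ℕ.^ N ℕ.< n ℕ.^ suc k
      2^N<n^k = fromℕ-cancel-< {2 ℕ.^ N} {n ℕ.^ suc k} (begin-strict
        fromℕ (2 ℕ.^ N)                                   ≡⟨ *-identityˡ _ ⟨
        1ℚ * fromℕ (2 ℕ.^ N)                              <⟨ *-monoʳ-< (0<m^k 2 N) large ⟩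
        ρ ^ N * fromℕ (n ℕ.^ suc k) * fromℕ (2 ℕ.^ N)
          ≤⟨ *-mono-≤ (<⇒≤ (0<m^k 2 N)) (0≤* (0≤^ 0≤½ N) (<⇒≤ (0<m^k n (suc k))))
               (*-mono-≤ (<⇒≤ (0<m^k n (suc k))) (0≤^ 0≤½ N) (^-monoˡ-≤ 0≤ρ ρ≤½ N) ≤-refl) ≤-refl ⟩
        ½ ^ N * fromℕ (n ℕ.^ suc k) * fromℕ (2 ℕ.^ N)
          ≡⟨ solve 3 (λ x y z → x :* y :* z := x :* z :* y)
                   refl (½ ^ N) (fromℕ (n ℕ.^ suc k)) (fromℕ (2 ℕ.^ N)) ⟩
        ½ ^ N * fromℕ (2 ℕ.^ N) * fromℕ (n ℕ.^ suc k)
          ≡⟨ cong (_* fromℕ (n ℕ.^ suc k)) (½^N*2^N≡1 N) ⟩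
        1ℚ * fromℕ (n ℕ.^ suc k)                          ≡⟨ *-identityˡ _ ⟩
        fromℕ (n ℕ.^ suc k)                               ∎)
        where open ≤-Reasoning
      γ≤D : γ ≤ fromℕ (N ℕ.+ n)
      γ≤D = begin
        γ                        ≡⟨ *-identityʳ γ ⟨
        γ * fromℕ 1
          ≤⟨ *-mono-≤ (from-yes (0ℚ ≤? 1ℚ)) (<⇒≤ 0<γ) ≤-refl (fromℕ-mono-≤ {1} {suc k} (ℕ.s≤s ℕ.z≤n)) ⟩
        γ * fromℕ (suc k)        ≡⟨ /-*-cancel (ℤ.+ N) (suc k) ⟩
        fromℕ N                  ≤⟨ fromℕ-mono-≤ {N} (ℕ.m≤m+n N n) ⟩
        fromℕ (N ℕ.+ n)          ∎
        where open ≤-Reasoning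

    -- Some g < γ is still above c, and ω g < 1 then certifies that - ω lies strictly above - 1 / c.
    ^-1/c-upper : ∀ {c γ ω u} → IsReal c → upper c γ → 0ℚ < ω → γ * ω ≡ 1ℚ →
                  upper (n ^ℚ (- ω)) u → upper (n ^ᴿ (-ᴿ recip c)) u
    ^-1/c-upper {ω = ω} c-real uγ 0<ω γω≡1 uu with g , g<γ , ug ← IsReal.upper-rounded c-real uγ =
      - ω ,
      (g , ug , subst₂ _<_ (solve 2 (λ g w → g :* w := :- (:- w) :* g) refl g ω) γω≡1 (*-monoʳ-< 0<ω g<γ)) ,
      uu

    upper⇒n^-1/c<ρ : ∀ {c} N k .{{_ : NonZero N}} .{{_ : NonZero k}} → IsReal c → upper c (ℤ.+ N / k) →
      1ℚ < ρ ^ N * fromℕ (n ℕ.^ k) → ∃[ u ] (0ℚ < u × u < ρ × upper (n ^ᴿ (-ᴿ recip c)) u)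
    upper⇒n^-1/c<ρ N k c-real uc large =
      let u , 0<u , u<ρ , 1<un = 1<^*-shrink {ρ} {fromℕ (n ℕ.^ k)} N (0<m^k n k)
                                 (1<p^k*x⇒0<p N 0≤ρ large) large
      in u , 0<u , u<ρ , ^-1/c-upper c-real uc (0</ k N) (/-*-/ N k)
                           (^ℚ-neg-upper n (ℤ.+ k / N) (lowest-terms k N) 0<u 1<un)

    -- Two cuts compare strictly only through a rational between them, hence u.
    Large⇒n^-1/c<ρ : ∀ {c} → IsReal c → fromℚ 1ℚ ≤ᴿ c → ∀ t → b *ᴿ c ≤ᴿ fromℚ (fromℕ t) → Large t →
                     ∃[ u ] (0ℚ < u × u < ρ × upper (n ^ᴿ (-ᴿ recip c)) u)
    Large⇒n^-1/c<ρ c-real 1≤c t bc≤t (β , zero , lβ , num , large) =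
      contradiction (<-≤-trans large (ρ^N≤1 (t ℕ.* ↧ₙ β))) (<-irrefl refl)
    Large⇒n^-1/c<ρ {c} c-real 1≤c zero bc≤t (β , suc k , lβ , num , large) =
      let c⁺ , uc⁺ = IsReal.upper-inhabited c-real
          lc = lower-below c-real 1≤c (from-yes (½ <? 1ℚ))
      in contradiction
           (<ᴿ-* {b} {c} {½} {½} {c⁺} {0ℚ} b-real lower-½ lc uc⁺ 0≤½ 0≤½ (lower≤upper c-real lc uc⁺) 0<¼) bc≤t
    Large⇒n^-1/c<ρ {c} c-real 1≤c t@(suc _) bc≤t (β , suc k , lβ , num , large) =
      upper⇒n^-1/c<ρ (t ℕ.* d) (suc k) {{ℕ.m*n≢0 t d}} c-real
        (≤ᴿ⇒upper-γ lβ 0<β 0<γ β*γ≡t c-real bc≤t) large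
      where open Exponent t lβ num

    -- Cancels κ and μ on the level of cuts: from n ^ (- 1 / c) < u < ρ, a rational a between u κ
    -- and ρ κ bounds the product, and subtracting μ gives a rational above the right side of the
    -- hypothesis and below r.
    ≤ᴿ⇒¬Large : ∀ {c κ μ r} → 0ℚ < κ → IsReal c → fromℚ 1ℚ ≤ᴿ c → r ≡ ρ * κ - μ →
                fromℚ r ≤ᴿ n ^ᴿ (-ᴿ recip c) *ᴿ fromℚ κ -ᴿ fromℚ μ →
                ∀ t → b *ᴿ c ≤ᴿ fromℚ (fromℕ t) → ¬ Large t
    ≤ᴿ⇒¬Large {c} {κ} {μ} {r} 0<κ c-real 1≤c r≡ r≤ t bc≤t large =
      strict (Large⇒n^-1/c<ρ c-real 1≤c t bc≤t large)
      where
      -- The interval product also asks for a lower endpoint of the root. A negative number is below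
      -- every power; the exponent - 4 is below - 1 / c because 1/2 < c and 1 < 4 (1/2).
      lower-root : lower (n ^ᴿ (-ᴿ recip c)) (- 1ℚ)
      lower-root = - fromℕ 4 ,
        (½ , lower-below c-real 1≤c (from-yes (½ <? 1ℚ)) , from-yes (0ℚ <? ½) ,
         from-yes (1ℚ <? - (- fromℕ 4) * ½)) ,
        inj₁ (from-yes (- 1ℚ <? 0ℚ))
      product : ∀ {u a D} → upper (n ^ᴿ (-ᴿ recip c)) u → κ < D → 0ℚ < a → u * D < a →
                upper (n ^ᴿ (-ᴿ recip c) *ᴿ fromℚ κ) a
      product {u} {a} {D} uu κ<D 0<a uD<a =
        -- The corners are 0, - D, 0 and u D; the first three are below a because a is positive.
        - 1ℚ , u , 0ℚ , D , (lower-root , uu , 0<κ , κ<D) ,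
        (subst (_< a) (sym (*-zeroʳ (- 1ℚ))) 0<a ,
         <-trans (subst (_< 0ℚ) (neg-distribˡ-*-1 D) (neg-antimono-< {0ℚ} {D} (<-trans 0<κ κ<D))) 0<a ,
         subst (_< a) (sym (*-zeroʳ u)) 0<a ,
         uD<a)
        where
        neg-distribˡ-*-1 : ∀ x → - x ≡ - 1ℚ * x
        neg-distribˡ-*-1 = solve 1 (λ x → :- x := con (- 1ℚ) :* x) refl
      difference : ∀ {a} → upper (n ^ᴿ (-ᴿ recip c) *ᴿ fromℚ κ) a → a < ρ * κ → ⊥
      difference {a} ua a<ρκ = r≤
          -- For a < y < ρ κ, the second summand exceeds - μ by y - a, and the total is y - μ, still
          -- below ρ κ - μ.
          (q , (a , y - a - μ , ua , -<μ , subst (_< q) shift y-μ<q) , subst (q <_) (sym r≡) q<)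
        where
        y q : ℚ
        y = proj₁ (<-dense a<ρκ)
        y-μ<ρκ-μ : y - μ < ρ * κ - μ
        y-μ<ρκ-μ = +-monoˡ-< (- μ) {y} {ρ * κ} (proj₂ (proj₂ (<-dense a<ρκ)))
        q = proj₁ (<-dense y-μ<ρκ-μ)
        y-μ<q : y - μ < q
        y-μ<q = proj₁ (proj₂ (<-dense y-μ<ρκ-μ))
        q< : q < ρ * κ - μ
        q< = proj₂ (proj₂ (<-dense y-μ<ρκ-μ))
        shift : y - μ ≡ a + (y - a - μ)
        shift = solve 3 (λ a x m → x :- m := a :+ (x :- a :- m)) refl a y μ
        a-y<0 : a - y < 0ℚ
        a-y<0 = subst (a - y <_) (+-inverseʳ y) (+-monoˡ-< (- y) {a} {y} (proj₁ (proj₂ (<-dense a<ρκ))))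
        -<μ : - (y - a - μ) < μ
        -<μ = subst₂ _<_ (solve 3 (λ a x m → (a :- x) :+ m := :- (x :- a :- m)) refl a y μ) (+-identityˡ μ)
                (+-monoˡ-< μ {a - y} {0ℚ} a-y<0)
      between : ∀ {u} → 0ℚ < u → upper (n ^ᴿ (-ᴿ recip c)) u →
                ∃[ a ] (u * κ < a × a < ρ * κ) → ⊥
      between {u} 0<u uu (a , uκ<a , a<ρκ) =
        let D , κ<D , uD<a = grow {a} {κ} {u} 0<u uκ<a
        in difference (product uu κ<D (<-trans (0<* 0<u 0<κ) uκ<a) uD<a) a<ρκ
      strict : ∃[ u ] (0ℚ < u × u < ρ × upper (n ^ᴿ (-ᴿ recip c)) u) → ⊥
      strict (u , 0<u , u<ρ , uu) = between 0<u uu (<-dense (*-monoʳ-< {u} {ρ} {κ} 0<κ u<ρ))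

-- The contraction rate

module _ where
  open import Data.Rational.Base using (_*_; _≤_)

  module Rate (K M : ℕ) .{{_ : NonTrivial K}} .{{_ : NonZero M}} (S : Subset M)
              (s≤M : ∣ S ∣ ℕ.≤ M) where
    open Mixnet K M S
    open MixnetProperties K M S

    private
      s k : ℚ
      s = fromℕ ∣ S ∣
      k = fromℕ (K ℕ.∸ 1)

    κ μ : ℚ
    κ = ℤ.+ (n ℕ.∸ 1) / (K ℕ.∸ 1)
    μ = ℤ.+ (n ℕ.∸ K) / (K ℕ.* (K ℕ.∸ 1))

    0<κ : 0ℚ < κ
    0<κ = *-cancelʳ-< (fromℕ-pos (K ℕ.∸ 1))
      (subst₂ _<_ (sym (*-zeroˡ k)) (sym (/-*-cancel (ℤ.+ (n ℕ.∸ 1)) (K ℕ.∸ 1))) (fromℕ-pos (n ℕ.∸ 1)))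

    fromℕ-∸ : ∀ {a b} → b ℕ.≤ a → fromℕ (a ℕ.∸ b) ≡ fromℕ a - fromℕ b
    fromℕ-∸ {a} {b} b≤a = begin
      fromℕ (a ℕ.∸ b)
        ≡⟨ solve 2 (λ x y → x := x :+ y :- y) refl (fromℕ (a ℕ.∸ b)) (fromℕ b) ⟩
      fromℕ (a ℕ.∸ b) + fromℕ b - fromℕ b
        ≡⟨ cong (_- fromℕ b) (trans (sym (fromℕ-+ (a ℕ.∸ b) b)) (cong fromℕ (ℕ.m∸n+n≡m b≤a))) ⟩
      fromℕ a - fromℕ b                        ∎
      where open ≡-Reasoning

    s≡[1-ρ]κ : s ≡ (1ℚ - ρ) * κ
    s≡[1-ρ]κ = begin
      s                                               ≡⟨ *-identityʳ s ⟨
      s * 1ℚ                                        ≡⟨ cong (s *_) e-inverse ⟨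
      s * ((fromℕ n - 1ℚ) * e)
        ≡⟨ cong (λ x → s * (x * e)) (trans (sym (fromℕ-∸1 n)) (sym (/-*-cancel (ℤ.+ (n ℕ.∸ 1)) (K ℕ.∸ 1)))) ⟩
      s * (κ * k * e)                           ≡⟨ cong (λ x → s * (κ * x * e)) (fromℕ-∸1 K) ⟩
      s * (κ * (fromℕ K - 1ℚ) * e)
        ≡⟨ solve 4 (λ s x k e → s :* (x :* k :* e) := (con 1ℚ :- (con 1ℚ :- s :* (k :* e))) :* x)
                 refl s κ (fromℕ K - 1ℚ) e ⟩
      (1ℚ - ρ) * κ                                ∎
      where open ≡-Reasoning

    -- Over the denominator K (K - 1) the numerator is K (n - 1) - (n - K) = n (K - 1) = M K (K -
    -- 1).
    κ-μ≡M : κ - μ ≡ fromℕ M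
    κ-μ≡M = fromℕ-cancelˡ (K ℕ.* (K ℕ.∸ 1)) $ begin
      fromℕ (K ℕ.* (K ℕ.∸ 1)) * (κ - μ)
        ≡⟨ solve 3 (λ c x y → c :* (x :- y) := x :* c :- y :* c) refl (fromℕ (K ℕ.* (K ℕ.∸ 1))) κ μ ⟩
      κ * fromℕ (K ℕ.* (K ℕ.∸ 1)) - μ * fromℕ (K ℕ.* (K ℕ.∸ 1))
        ≡⟨ cong₂ _-_ (cong (κ *_) (fromℕ-* K (K ℕ.∸ 1))) (/-*-cancel (ℤ.+ (n ℕ.∸ K)) (K ℕ.* (K ℕ.∸ 1))) ⟩
      κ * (fromℕ K * k) - fromℕ (n ℕ.∸ K)
        ≡⟨ solve 4 (λ x K k m → x :* (K :* k) :- m := K :* (x :* k) :- m)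
                 refl κ (fromℕ K) k (fromℕ (n ℕ.∸ K)) ⟩
      fromℕ K * (κ * k) - fromℕ (n ℕ.∸ K)
        ≡⟨ cong₂ (λ x y → fromℕ K * x - y)
             (trans (/-*-cancel (ℤ.+ (n ℕ.∸ 1)) (K ℕ.∸ 1)) (trans (fromℕ-∸1 n) (cong (_- 1ℚ) (fromℕ-* M K))))
             (trans (fromℕ-∸ (ℕ.m≤n*m K M)) (cong (_- fromℕ K) (fromℕ-* M K))) ⟩
      fromℕ K * (fromℕ M * fromℕ K - 1ℚ) - (fromℕ M * fromℕ K - fromℕ K)
        ≡⟨ solve 2 (λ K M → K :* (M :* K :- con 1ℚ) :- (M :* K :- K) := K :* (K :- con 1ℚ) :* M)
                 refl (fromℕ K) (fromℕ M) ⟩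
      fromℕ K * (fromℕ K - 1ℚ) * fromℕ M
        ≡⟨ cong (_* fromℕ M) (trans (cong (fromℕ K *_) (sym (fromℕ-∸1 K))) (sym (fromℕ-* K (K ℕ.∸ 1)))) ⟩
      fromℕ (K ℕ.* (K ℕ.∸ 1)) * fromℕ M ∎
      where open ≡-Reasoning

    M-s≡ρκ-μ : fromℕ (M ℕ.∸ ∣ S ∣) ≡ ρ * κ - μ
    M-s≡ρκ-μ = begin
      fromℕ (M ℕ.∸ ∣ S ∣)                    ≡⟨ fromℕ-∸ s≤M ⟩
      fromℕ M - s                        ≡⟨ cong₂ _-_ (sym κ-μ≡M) s≡[1-ρ]κ ⟩
      κ - μ - (1ℚ - ρ) * κ
        ≡⟨ solve 3 (λ x m r → x :- m :- (con 1ℚ :- r) :* x := r :* x :- m) refl κ μ ρ ⟩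
      ρ * κ - μ                        ∎
      where open ≡-Reasoning

    0≤fromℕ : ∀ m → 0ℚ ≤ fromℕ m
    0≤fromℕ m = fromℕ-mono-≤ {0} {m} ℕ.z≤n

    *κ-cancel-≤ : ∀ {p q} → p * κ ≤ q * κ → p ≤ q
    *κ-cancel-≤ = *-cancelʳ-≤-pos κ {{positive 0<κ}}

    -- ρ κ = (M - s) + μ is a sum of nonnegative terms.
    0≤ρ : 0ℚ ≤ ρ
    0≤ρ = *κ-cancel-≤ (begin
      0ℚ * κ                     ≡⟨ *-zeroˡ κ ⟩
      0ℚ
        ≤⟨ +-mono-≤ (0≤fromℕ (M ℕ.∸ ∣ S ∣)) (0≤/ (n ℕ.∸ K) (K ℕ.* (K ℕ.∸ 1))) ⟩
      fromℕ (M ℕ.∸ ∣ S ∣) + μ      ≡⟨ cong (_+ μ) M-s≡ρκ-μ ⟩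
      ρ * κ - μ + μ          ≡⟨ solve 2 (λ x y → x :- y :+ y := x) refl (ρ * κ) μ ⟩
      ρ * κ                      ∎)
      where open ≤-Reasoning

    ρ≤1 : ρ ≤ 1ℚ
    ρ≤1 = *κ-cancel-≤ (begin
      ρ * κ                           ≡⟨ +-identityʳ _ ⟨
      ρ * κ + 0ℚ                    ≤⟨ +-monoʳ-≤ (ρ * κ) (0≤fromℕ ∣ S ∣) ⟩
      ρ * κ + s                     ≡⟨ cong (ρ * κ +_) s≡[1-ρ]κ ⟩
      ρ * κ + (1ℚ - ρ) * κ
        ≡⟨ solve 2 (λ r x → r :* x :+ (con 1ℚ :- r) :* x := con 1ℚ :* x) refl ρ κ ⟩
      1ℚ * κ                          ∎)
      where open ≤-Reasoning

    𝔼Φ≤ρ^t : ∀ t → 𝔼Φ t ≤ ρ ^ t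
    𝔼Φ≤ρ^t t = begin
      𝔼Φ t                             ≡⟨ 𝔼Φ-formula t ⟩
      ρ ^ t * (1ℚ - h)             ≤⟨ *-monoˡ-≤-nonNeg (ρ ^ t) {{nonNegative (0≤^ 0≤ρ t)}}
                                            (+-monoʳ-≤ 1ℚ (neg-antimono-≤ (0≤/ 1 n))) ⟩
      ρ ^ t * (1ℚ - 0ℚ)            ≡⟨ *-identityʳ (ρ ^ t) ⟩
      ρ ^ t                            ∎
      where
      open ≤-Reasoning
      h = ℤ.+ 1 / n

open import Data.Integer.Base using (+_)
open import Data.Nat.Base using (_*_; _∸_; _≤_)

theorem2 : (K M s : ℕ) .{{_ : NonTrivial K}} .{{_ : NonZero M}} →
    1 ≤ s → s ≤ M →
    (S : Subset M) → ∣ S ∣ ≡ s →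
    (b : Cut) → IsReal b → fromℚ 1ℚ ≤ᴿ b →
    let open Mixnet K M S in
    ( (ε : Cut) → IsReal ε → fromℚ ½ ≤ᴿ ε →
    ε *ᴿ fromℚ (+ (n ∸ 1) / (K ∸ 1)) ≤ᴿ fromℚ (fromℕ s) →
    (t : ℕ) → t ≡⌈ b *ᴿ log₂ n ⌉ →
    fromℚ (𝔼Φ t) ≤ᴿ recip (n ^ᴿ b) )
    ×
    ( (c : Cut) → IsReal c → fromℚ 1ℚ ≤ᴿ c →
    n ^ᴿ recip c ≤ᴿ fromℚ (fromℕ K) →
    fromℚ (fromℕ (M ∸ s)) ≤ᴿ
    n ^ᴿ (-ᴿ recip c) *ᴿ fromℚ (+ (n ∸ 1) / (K ∸ 1))
    -ᴿ fromℚ (+ (n ∸ K) / (K * (K ∸ 1))) →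
    (t : ℕ) → t ≡⌈ b *ᴿ c ⌉ →
    fromℚ (𝔼Φ t) ≤ᴿ recip (n ^ᴿ b) )
theorem2 K M _ _ s≤M S refl b b-real 1≤b =
  (λ ε ε-real ½≤ε εκ≤s t (_ , b*log≤t) → ≤ᴿ-recip n b b-real 1≤b 0≤ρ ρ≤1 {t} (𝔼Φ≤ρ^t t)
     (≤ᴿ⇒¬Large-log₂ n b b-real 1≤b 0≤ρ ρ≤1 n>1
       (≤ᴿ⇒ρ≤½ 0<κ ε-real ½≤ε (0≤fromℕ ∣ S ∣) s≡[1-ρ]κ εκ≤s)
       t b*log≤t)) ,
  (λ c c-real 1≤c _ M-s≤ t (_ , bc≤t) → ≤ᴿ-recip n b b-real 1≤b 0≤ρ ρ≤1 {t} (𝔼Φ≤ρ^t t)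
     (≤ᴿ⇒¬Large n b b-real 1≤b 0≤ρ ρ≤1 0<κ c-real 1≤c M-s≡ρκ-μ M-s≤ t bc≤t))
  where
  open Mixnet K M S using (n; n≢0; 𝔼Φ)
  open MixnetProperties K M S using (n>1; ρ)
  open Rate K M S s≤M
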